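{- For every undirected edge-capacitated graph $G=(V,E)$ with capacities $c$ and every terminal set $K\subseteq V$ with $|K|=k$, there is an $O(\log k)$-oblivious routing scheme for $K$-flows in $G$.
   Context: A $K$-flow is a multicommodity flow all of whose sources and sinks lie in $K$. An oblivious routing scheme for $K$-flows specifies, for each pair of terminals $s,t\in K$, a fixed unit flow from $s$ to $t$ in $G$ (independent of the demands); given demands $D:K\times K\to\mathbb{R}_{\ge0}$, each demand $D(s,t)$ is routed by scaling the corresponding unit flow by $D(s,t)$. The congestion of a routing is the maximum over edges $e$ of the total flow on $e$ divided by $c(e)$. The scheme is $\alpha$-oblivious if for every demand $D$ on $K\times K$ the congestion of the oblivious routing of $D$ is at most $\alpha$ times the minimum congestion over all multicommodity flows in $G$ routing $D$. The $O(\cdot)$ hides an absolute constant, for $k\ge2$. -}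

module Defs where

open import Algebra.Apartness.Structures using (IsHeytingField)
open import Algebra.Bundles using (CommutativeRing)
import Algebra.Definitions.RawMonoid as RawMonoid
open import Data.Bool.Base using (if_then_else_)
open import Data.Fin.Base as Fin using (Fin)
open import Data.Fin.Properties using (_≟_)
open import Data.Nat.Base as ℕ using (ℕ)
open import Data.Product.Base using (_×_; _,_; ∃-syntax; proj₁; proj₂)
open import Data.Sum.Base using (_⊎_; inj₂)
open import Data.Vec.Functional using (foldr)
open import Function.Bundles using (_↣_; Injection)
open import Function.Definitions using (Injective)
open import Level using (0ℓ)
open import Relation.Binary.Construct.Closure.Equivalence using (EqClosure)
open import Relation.Binary.Definitions using (Cotransitive)
open import Relation.Binary.Lattice.Definitions using (Supremum)
open import Relation.Binary.PropositionalEquality.Core using (_≡_)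
open import Relation.Binary.Structures using (IsStrictPartialOrder)
open import Relation.Nullary.Decidable.Core using (does)
open import Relation.Nullary.Negation.Core using (¬_)

-- The real numbers, axiomatised as a Cauchy complete Archimedean ordered field
-- with binary maxima.  The axioms are the constructive ones (order is
-- cotransitive rather than decidable, only elements apart from 0 are
-- invertible), so that Bishop's reals are a model; classically they
-- characterise ℝ up to isomorphism.
record Reals : Set₁ where
  infix  8 -_
  infixl 7 _*_
  infixl 6 _+_
  infixl 5 _∨_
  infix  4 _≈_ _<_ _≤_ _#_
  field
    Carrier  : Set
    _≈_ _<_ : Carrier → Carrier → Set
    _+_ _*_  : Carrier → Carrier → Carrier
    -_       : Carrier → Carrier
    0# 1#    : Carrier
    _∨_      : Carrier → Carrier → Carrier

  _≤_ : Carrier → Carrier → Set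
  x ≤ y = ¬ (y < x)

  _#_ : Carrier → Carrier → Set
  x # y = (x < y) ⊎ (y < x)

  field
    isHeytingField       : IsHeytingField _≈_ _#_ _+_ _*_ -_ 0# 1#
    isStrictPartialOrder : IsStrictPartialOrder _≈_ _<_
    <-cotransitive       : Cotransitive _<_
    +-monoˡ-<            : ∀ z {x y} → x < y → x + z < y + z
    *-pos                : ∀ {x y} → 0# < x → 0# < y → 0# < x * y
    ∨-supremum           : Supremum _≤_ _∨_

  open IsHeytingField isHeytingField public
    using (isCommutativeRing; _-_; #⇒invertible)

  commutativeRing : CommutativeRing 0ℓ 0ℓ
  commutativeRing = record { isCommutativeRing = isCommutativeRing }

  open RawMonoid (CommutativeRing.+-rawMonoid commutativeRing) public
    using (sum) renaming (_×_ to infixr 8 _·_)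

  field
    archimedean : ∀ x → ∃[ n ] x < n · 1#
    complete    : ∀ (x : ℕ → Carrier) →
                  (∀ p → ∃[ N ] ∀ i j → N ℕ.≤ i → N ℕ.≤ j →
                     p · (x i - x j) ≤ 1#) →
                  ∃[ l ] ∀ p → ∃[ N ] ∀ i → N ℕ.≤ i →
                     (p · (x i - l) ≤ 1#) × (p · (l - x i) ≤ 1#)

  -- The library's inverse is that of y - 0#, which is ≈ y.
  divide : Carrier → (y : Carrier) → 0# < y → Carrier
  divide x y 0<y = x * proj₁ (#⇒invertible {y} {0#} (inj₂ 0<y))

-- A finite simple undirected graph on Fin ∣V∣ with positive edge capacities.
-- The unordered pair {u , v} with u < v is listed as (u , v), which also gives
-- every edge a reference orientation.
record Network (R : Reals) : Set where
  open Reals R using (Carrier; 0#; _<_)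
  field
    ∣V∣ ∣E∣  : ℕ
    ends     : Fin ∣E∣ → Fin ∣V∣ × Fin ∣V∣
    ordered  : ∀ e → proj₁ (ends e) Fin.< proj₂ (ends e)
    simple   : Injective _≡_ _≡_ ends
    cap      : Fin ∣E∣ → Carrier
    cap-pos  : ∀ e → 0# < cap e

  Connected : Fin ∣V∣ → Fin ∣V∣ → Set
  Connected = EqClosure λ u v → ∃[ e ] ends e ≡ (u , v)

module _ {R : Reals} (G : Network R) where
  open Reals R
  open Network G

  -- Amounts sent along an edge (u , v) from u to v, and from v to u.
  record Flow : Set where
    field
      fwd bwd : Fin ∣E∣ → Carrier

  open Flow

  [_≡?_] : Fin ∣V∣ → Fin ∣V∣ → Carrier
  [ u ≡? v ] = if does (u ≟ v) then 1# else 0#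

  netOut : Flow → Fin ∣V∣ → Carrier
  netOut f v = sum λ e →
    ([ proj₁ (ends e) ≡? v ] - [ proj₂ (ends e) ≡? v ]) * (fwd f e - bwd f e)

  record IsFlow (s t : Fin ∣V∣) (d : Carrier) (f : Flow) : Set where
    field
      fwd-nonneg   : ∀ e → 0# ≤ fwd f e
      bwd-nonneg   : ∀ e → 0# ≤ bwd f e
      conservation : ∀ v → netOut f v ≈ d * ([ s ≡? v ] - [ t ≡? v ])

  scale : Carrier → Flow → Flow
  scale d f = record { fwd = λ e → d * fwd f e ; bwd = λ e → d * bwd f e }

  -- The terminal set is the image of K, so it has exactly k elements and K × K
  -- is indexed by Fin k × Fin k.
  module _ {k : ℕ} (K : Fin k ↣ Fin ∣V∣) where
    open Injection K using (to)

    Demand : Set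
    Demand = Fin k → Fin k → Carrier

    Multiflow : Set
    Multiflow = Fin k → Fin k → Flow

    Routes : Demand → Multiflow → Set
    Routes D F = ∀ s t → IsFlow (to s) (to t) (D s t) (F s t)

    load : Multiflow → Fin ∣E∣ → Carrier
    load F e = sum λ s → sum λ t → fwd (F s t) e + bwd (F s t) e

    -- Loads are nonnegative, so starting from 0# affects only edgeless graphs.
    congestion : Multiflow → Carrier
    congestion F = foldr _∨_ 0# λ e → divide (load F e) (cap e) (cap-pos e)

    -- G may be disconnected; a unit flow from s to t is required exactly for
    -- the pairs that have one.  For the other pairs every routable demand is 0.
    record ObliviousScheme : Set where
      field
        flow : Multiflow
        unit : ∀ s t → Connected (to s) (to t) →
               IsFlow (to s) (to t) 1# (flow s t)

      routing : Demand → Multiflow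
      routing D s t = scale (D s t) (flow s t)

    -- "At most α times the minimum congestion" is a bound against every
    -- multicommodity flow F routing D.
    IsOblivious : Carrier → ObliviousScheme → Set
    IsOblivious α S =
      ∀ (D : Demand) → (∀ s t → 0# ≤ D s t) →
      ∀ (F : Multiflow) → Routes D F →
      congestion (ObliviousScheme.routing S D) ≤ α * congestion F

{-# OPTIONS --safe #-}

-- A matrix M assigning to every vertex v a vector M v of signed edge amounts yields the scheme that
-- routes s to t along M s - M t.  If the terminals s of a component all have boundary of M s equal
-- to 1_s minus a common vector, these are unit flows, and summation by parts against the potential
-- v ↦ M v h shows that the scheme is α-oblivious once Σ_e c(e) ∣M (src e) h - M (dst e) h∣ ≤ α c(h)
-- for every edge h.  By Blackwell approachability such an M is an average of matrices M_y, one for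
-- each of finitely many integral length functions y, where M_y stretches each edge e to y-norm at
-- most O(log k) y(e).
--
-- For given lengths, let μ_r(v) be the uniform distribution on the terminals at distance less than r
-- from v.  M_y v moves mass along short walks from μ_r(v) to μ_{2r}(v) and μ_{2r+1}(v), half each,
-- starting from r = 1, so that the path through the dyadic tree of radii telescopes.  The stretch of
-- an edge uv is at most a constant times Σ_r ‖μ_r(u) - μ_r(v)‖₁, and with N(r) terminals within r of
-- u and D the length of uv, ‖μ_r(u) - μ_r(v)‖₁ ≤ 2 (1 - N(r-D) / N(r+D)) ≤ 2 (H(N(r+D)) - H(N(r-D)))
-- for the harmonic numbers H, which sums to O(D log k).
module Submission where

open import Defs
open import Algebra.Apartness.Structures using (IsHeytingField)
open import Algebra.Bundles using (CommutativeRing; RawRing)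
import Algebra.Properties.CommutativeSemigroup
import Algebra.Properties.Ring
import Algebra.Properties.Semiring.Mult
import Algebra.Properties.Semiring.Sum
import Algebra.Solver.Ring
import Algebra.Solver.Ring.AlmostCommutativeRing as ACR
open import Data.Bool.Base using (Bool; true; false; T; if_then_else_)
open import Data.Empty using (⊥; ⊥-elim)
open import Data.Fin.Base using (Fin; zero; suc)
open import Data.Fin.Properties using (_≟_; any?)
open import Data.Maybe.Base using (Maybe; just; nothing)
open import Data.Nat.Base as ℕ using (ℕ; zero; suc; ⌈_/2⌉)
open import Data.Nat.Induction using (<-wellFounded)
open import Data.Nat.Logarithm using (⌈log₂_⌉; ⌈log₂⌈n/2⌉⌉≡⌈log₂n⌉∸1; ⌈log₂⌉-mono-≤)
import Data.Nat.Properties as ℕ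
import Data.Nat.Solver
open import Data.Product.Base using (Σ; ∃-syntax; _×_; _,_; proj₁; proj₂)
open import Data.Sum.Base using (_⊎_; inj₁; inj₂)
open import Data.Vec.Functional using (foldr; _∷_)
open import Function.Base using (_∘_)
open import Function.Bundles using (_↣_; Injection)
open import Induction.WellFounded using (Acc; acc)
open import Level using (0ℓ)
open import Relation.Binary.Bundles using (Poset)
import Relation.Binary.Construct.Closure.Equivalence as Closure
open import Relation.Binary.Definitions using (Reflexive; Symmetric; Transitive)
open import Relation.Binary.PropositionalEquality.Core as ≡ using (_≡_)
import Relation.Binary.PropositionalEquality.Properties as ≡
import Relation.Binary.Reasoning.PartialOrder
import Relation.Binary.Reasoning.Setoid
open import Relation.Binary.Structures using (IsStrictPartialOrder)
open import Relation.Nullary.Decidable.Core as Dec using (Dec; yes; no; does; _×-dec_; _⊎-dec_)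
open import Relation.Nullary.Negation.Core using (¬_; contradiction)

private
  module ℕ-Solver = Data.Nat.Solver.+-*-Solver

-- Arithmetic over the axiomatised reals.

module RealArithmetic (R : Reals) where
  open Reals R public
  open CommutativeRing commutativeRing public using
    ( refl; sym; trans; setoid; +-cong; +-congˡ; +-congʳ; *-cong; *-congˡ; *-congʳ; -‿cong
    ; +-comm; +-identityˡ; +-identityʳ; -‿inverseʳ
    ; *-assoc; *-comm; *-identityˡ; *-identityʳ; zeroˡ; zeroʳ; distribˡ; distribʳ; semiring
    ; reflexive )
  open Algebra.Properties.Semiring.Sum semiring public using
    (sum-cong-≋; ∑-distrib-+; ∑-comm; *-distribˡ-sum; *-distribʳ-sum; sum-replicate-zero)
  open Algebra.Properties.Semiring.Mult semiring public using
    (×-homo-+; ×1-homo-*; ×-assoc-*; ×-congʳ)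

  private
    module <-Order = IsStrictPartialOrder isStrictPartialOrder

  -- Ring solver with coefficients in ℤ, represented as formal differences.
  private
    module CR = CommutativeRing commutativeRing
    module RP = Algebra.Properties.Ring CR.ring

    ⟦_⟧ᶜ : ℕ × ℕ → Carrier
    ⟦ 0           , 0     ⟧ᶜ = 0#
    ⟦ 1           , 0     ⟧ᶜ = 1#
    ⟦ m           , n     ⟧ᶜ = m · 1# - n · 1#

    -- The solver compares normal forms syntactically, so coefficients must be canonical.
    reduce : ℕ → ℕ → ℕ × ℕ
    reduce m n = m ℕ.∸ n , n ℕ.∸ m

    differences : RawRing 0ℓ 0ℓ
    differences = record
      { Carrier = ℕ × ℕ
      ; _≈_     = _≡_
      ; _+_     = λ (m , n) (p , q) → reduce (m ℕ.+ p) (n ℕ.+ q)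
      ; _*_     = λ (m , n) (p , q) → reduce (m ℕ.* p ℕ.+ n ℕ.* q) (m ℕ.* q ℕ.+ n ℕ.* p)
      ; -_      = λ (m , n) → n , m
      ; 0#      = 0 , 0
      ; 1#      = 1 , 0
      }

    x-0≈x : ∀ x → x - 0# ≈ x
    x-0≈x x = trans (+-congˡ RP.-0#≈0#) (+-identityʳ x)

    ⟦⟧ᶜ-difference : ∀ m n → ⟦ m , n ⟧ᶜ ≈ m · 1# - n · 1#
    ⟦⟧ᶜ-difference 0             0       = sym (x-0≈x 0#)
    ⟦⟧ᶜ-difference 1             0       = sym (trans (x-0≈x _) (+-identityʳ 1#))
    ⟦⟧ᶜ-difference (suc (suc m)) 0       = refl
    ⟦⟧ᶜ-difference 0             (suc n) = refl
    ⟦⟧ᶜ-difference 1             (suc n) = refl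
    ⟦⟧ᶜ-difference (suc (suc m)) (suc n) = refl

    open Algebra.Properties.CommutativeSemigroup CR.+-commutativeSemigroup
      using (interchange)

    difference-+ : ∀ a b c d → (a + c) - (b + d) ≈ (a - b) + (c - d)
    difference-+ a b c d = trans (+-congˡ (sym (RP.-‿+-comm b d))) (interchange a c (- b) (- d))

    difference-neg : ∀ a b → b - a ≈ - (a - b)
    difference-neg a b = trans (+-comm b (- a))
      (trans (+-congˡ (sym (RP.-‿involutive b))) (RP.-‿+-comm a (- b)))

    difference-* : ∀ a b c d → (a * c + b * d) - (a * d + b * c) ≈ (a - b) * (c - d)
    difference-* a b c d = sym (trans (distribʳ (c - d) a (- b))
      (trans (+-cong
        (trans (distribˡ a c (- d)) (+-congˡ (sym (RP.-‿distribʳ-* a d))))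
        (trans (sym (RP.-‿distribˡ-* b (c - d)))
          (trans (-‿cong (trans (distribˡ b c (- d)) (+-congˡ (sym (RP.-‿distribʳ-* b d)))))
            (sym (difference-neg (b * c) (b * d))))))
        (sym (difference-+ (a * c) (a * d) (b * d) (b * c)))))

    ·-+ : ∀ m n → (m ℕ.+ n) · 1# ≈ m · 1# + n · 1#
    ·-+ = ×-homo-+ 1#

    difference-shift : ∀ a b d → (a + d) - (b + d) ≈ a - b
    difference-shift a b d = trans (difference-+ a b d d)
      (trans (+-congˡ (-‿inverseʳ d)) (+-identityʳ (a - b)))

    difference-cancel : ∀ {a b c d} → a + d ≈ c + b → a - b ≈ c - d
    difference-cancel {a} {b} {c} {d} eq = trans (sym (difference-shift a b d))
      (trans (+-cong eq (-‿cong (+-comm b d))) (difference-shift c d b))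

    ∸-balance : ∀ m n → (m ℕ.∸ n) ℕ.+ n ≡ m ℕ.+ (n ℕ.∸ m)
    ∸-balance zero    zero    = ≡.refl
    ∸-balance zero    (suc n) = ≡.refl
    ∸-balance (suc m) zero    = ≡.refl
    ∸-balance (suc m) (suc n) = ≡.trans (ℕ.+-suc (m ℕ.∸ n) n) (≡.cong suc (∸-balance m n))

    ⟦reduce⟧ : ∀ m n → ⟦ reduce m n ⟧ᶜ ≈ m · 1# - n · 1#
    ⟦reduce⟧ m n = trans (⟦⟧ᶜ-difference (m ℕ.∸ n) (n ℕ.∸ m))
      (difference-cancel (trans (sym (·-+ (m ℕ.∸ n) n))
        (trans (reflexive (≡.cong (_· 1#) (∸-balance m n))) (·-+ m (n ℕ.∸ m)))))

    morphism : differences ACR.-Raw-AlmostCommutative⟶ ACR.fromCommutativeRing commutativeRing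
    morphism = record
      { ⟦_⟧    = ⟦_⟧ᶜ
      ; +-homo = λ (m , n) (p , q) → trans (⟦reduce⟧ (m ℕ.+ p) (n ℕ.+ q))
          (trans (+-cong (·-+ m p) (-‿cong (·-+ n q)))
            (trans (difference-+ _ _ _ _)
              (sym (+-cong (⟦⟧ᶜ-difference m n) (⟦⟧ᶜ-difference p q)))))
      ; *-homo = λ (m , n) (p , q) → trans (⟦reduce⟧ (m ℕ.* p ℕ.+ n ℕ.* q) (m ℕ.* q ℕ.+ n ℕ.* p))
          (trans (+-cong (trans (·-+ (m ℕ.* p) (n ℕ.* q)) (+-cong (×1-homo-* m p) (×1-homo-* n q)))
                 (-‿cong (trans (·-+ (m ℕ.* q) (n ℕ.* p)) (+-cong (×1-homo-* m q) (×1-homo-* n p)))))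
            (trans (difference-* _ _ _ _)
              (sym (*-cong (⟦⟧ᶜ-difference m n) (⟦⟧ᶜ-difference p q)))))
      ; -‿homo = λ (m , n) → trans (⟦⟧ᶜ-difference n m)
          (trans (difference-neg _ _) (-‿cong (sym (⟦⟧ᶜ-difference m n))))
      ; 0-homo = refl
      ; 1-homo = refl
      }

    coefficient≟ : ∀ (x y : ℕ × ℕ) → Maybe (⟦ x ⟧ᶜ ≈ ⟦ y ⟧ᶜ)
    coefficient≟ (m , n) (p , q) with m ℕ.+ q ℕ.≟ p ℕ.+ n
    ... | no _   = nothing
    ... | yes eq = just (trans (⟦⟧ᶜ-difference m n) (trans
            (difference-cancel (trans (sym (·-+ m q)) (trans (reflexive (≡.cong (_· 1#) eq)) (·-+ p n))))
            (sym (⟦⟧ᶜ-difference p q))))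

  open Algebra.Solver.Ring differences (ACR.fromCommutativeRing commutativeRing) morphism coefficient≟
    public using (solve; _:=_; _:+_; _:*_; _:-_; :-_; _:×_; con; Polynomial)

  :0 :1 : ∀ {n} → Polynomial n
  :0 = con (0 , 0)
  :1 = con (1 , 0)

  -- Order and its compatibility with the field operations.

  open <-Order public using () renaming (irrefl to <-irrefl; asym to <-asym)

  private
    variable
      a b c d x y z : Carrier
      n : ℕ

  <-respʳ-≈ : x ≈ y → z < x → z < y
  <-respʳ-≈ = proj₁ <-Order.<-resp-≈

  <-respˡ-≈ : x ≈ y → x < z → y < z
  <-respˡ-≈ = proj₂ <-Order.<-resp-≈

  <⇒≤ : x < y → x ≤ y
  <⇒≤ = <-asym

  ≤-reflexive : x ≈ y → x ≤ y
  ≤-reflexive eq = <-irrefl (sym eq)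

  ≤-refl : x ≤ x
  ≤-refl = ≤-reflexive refl

  <-≤-trans : x < y → y ≤ z → x < z
  <-≤-trans {z = z} x<y y≤z with <-cotransitive x<y z
  ... | inj₁ x<z = x<z
  ... | inj₂ z<y = ⊥-elim (y≤z z<y)

  ≤-<-trans : x ≤ y → y < z → x < z
  ≤-<-trans {x = x} x≤y y<z with <-cotransitive y<z x
  ... | inj₁ y<x = ⊥-elim (x≤y y<x)
  ... | inj₂ x<z = x<z

  ≤-trans : x ≤ y → y ≤ z → x ≤ z
  ≤-trans x≤y y≤z z<x = x≤y (≤-<-trans y≤z z<x)

  ≤-antisym : x ≤ y → y ≤ x → x ≈ y
  ≤-antisym {x} {y} x≤y y≤x = proj₁ (IsHeytingField.tight isHeytingField x y)
    λ { (inj₁ x<y) → y≤x x<y ; (inj₂ y<x) → x≤y y<x }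

  ≤-poset : Poset 0ℓ 0ℓ 0ℓ
  ≤-poset = record { _≈_ = _≈_ ; _≤_ = _≤_ ; isPartialOrder = record
    { isPreorder = record { isEquivalence = CommutativeRing.isEquivalence commutativeRing
                          ; reflexive = ≤-reflexive ; trans = ≤-trans }
    ; antisym = ≤-antisym } }

  module ≤-Reasoning = Relation.Binary.Reasoning.PartialOrder ≤-poset
    using (begin_; _∎; step-≤; step-≈-⟩; step-≈-⟨)

  -- _≤_ is a negation, hence admits case analysis on the order.
  ≤-by-cases : ∀ x y → (x ≤ y → a ≤ b) → (y ≤ x → a ≤ b) → a ≤ b
  ≤-by-cases x y f g b<a = f (λ y<x → g (<⇒≤ y<x) b<a) b<a

  x<y⇒0<y-x : x < y → 0# < y - x
  x<y⇒0<y-x {x} x<y = <-respˡ-≈ (-‿inverseʳ x) (+-monoˡ-< (- x) x<y)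

  0<y-x⇒x<y : 0# < y - x → x < y
  0<y-x⇒x<y {y} {x} 0<y-x = <-respˡ-≈ (+-identityˡ x)
    (<-respʳ-≈ (solve 2 (λ y x → (y :- x) :+ x := y) refl y x) (+-monoˡ-< x 0<y-x))

  x≤y⇒0≤y-x : x ≤ y → 0# ≤ y - x
  x≤y⇒0≤y-x {x} {y} x≤y y-x<0 = x≤y (0<y-x⇒x<y
    (<-respʳ-≈ (solve 2 (λ y x → :0 :- (y :- x) := x :- y) refl y x) (x<y⇒0<y-x y-x<0)))

  0≤y-x⇒x≤y : 0# ≤ y - x → x ≤ y
  0≤y-x⇒x≤y {y} {x} 0≤y-x y<x = 0≤y-x (0<y-x⇒x<y
    (<-respʳ-≈ (solve 2 (λ y x → x :- y := :0 :- (y :- x)) refl y x) (x<y⇒0<y-x y<x)))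

  ≤-gap : y - x ≈ d → 0# ≤ d → x ≤ y
  ≤-gap eq 0≤d = 0≤y-x⇒x≤y (≤-trans 0≤d (≤-reflexive (sym eq)))

  +-nonneg : 0# ≤ x → 0# ≤ y → 0# ≤ x + y
  +-nonneg {x} {y} 0≤x 0≤y x+y<0 = 0≤y (≤-<-trans (λ x+y<y → 0≤x
    (0<y-x⇒x<y (<-respʳ-≈ (solve 2 (λ x y → y :- (x :+ y) := :0 :- x) refl x y) (x<y⇒0<y-x x+y<y))))
    x+y<0)

  +-mono-≤ : a ≤ b → c ≤ d → a + c ≤ b + d
  +-mono-≤ {a} {b} {c} {d} a≤b c≤d = ≤-gap
    (solve 4 (λ a b c d → (b :+ d) :- (a :+ c) := (b :- a) :+ (d :- c)) refl a b c d)
    (+-nonneg (x≤y⇒0≤y-x a≤b) (x≤y⇒0≤y-x c≤d))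

  neg-mono-≤ : x ≤ y → - y ≤ - x
  neg-mono-≤ {x} {y} x≤y = ≤-gap (solve 2 (λ x y → :- x :- (:- y) := y :- x) refl x y) (x≤y⇒0≤y-x x≤y)

  *-nonneg : 0# ≤ x → 0# ≤ y → 0# ≤ x * y
  *-nonneg {x} {y} 0≤x 0≤y xy<0 = x≤0 λ 0<x → y≤0 0<x λ 0<y → <-asym xy<0 (*-pos 0<x 0<y)
    where
    x≤0 : ¬ ¬ (0# < x)
    x≤0 0≮x = <-irrefl (trans (*-congʳ (≤-antisym 0≮x 0≤x)) (zeroˡ y)) xy<0
    y≤0 : 0# < x → ¬ ¬ (0# < y)
    y≤0 _ 0≮y = <-irrefl (trans (*-congˡ (≤-antisym 0≮y 0≤y)) (zeroʳ x)) xy<0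

  *-monoˡ-≤ : 0# ≤ c → a ≤ b → c * a ≤ c * b
  *-monoˡ-≤ {c} {a} {b} 0≤c a≤b = ≤-gap
    (solve 3 (λ a b c → c :* b :- c :* a := c :* (b :- a)) refl a b c)
    (*-nonneg 0≤c (x≤y⇒0≤y-x a≤b))

  *-monoʳ-≤ : 0# ≤ c → a ≤ b → a * c ≤ b * c
  *-monoʳ-≤ {c} {a} {b} 0≤c a≤b = ≤-gap
    (solve 3 (λ a b c → b :* c :- a :* c := c :* (b :- a)) refl a b c)
    (*-nonneg 0≤c (x≤y⇒0≤y-x a≤b))

  *-cancelʳ-≤ : 0# < c → a * c ≤ b * c → a ≤ b
  *-cancelʳ-≤ {c} {a} {b} 0<c ac≤bc b<a = ac≤bc (0<y-x⇒x<y (<-respʳ-≈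
    (solve 3 (λ a b c → (a :- b) :* c := a :* c :- b :* c) refl a b c) (*-pos (x<y⇒0<y-x b<a) 0<c)))

  square-nonneg : ∀ x → 0# ≤ x * x
  square-nonneg x = ≤-by-cases 0# x (λ 0≤x → *-nonneg 0≤x 0≤x)
    λ x≤0 → ≤-trans (*-nonneg (x≤y⇒0≤y-x x≤0) (x≤y⇒0≤y-x x≤0))
      (≤-reflexive (solve 1 (λ x → (:0 :- x) :* (:0 :- x) := x :* x) refl x))

  0≤1 : 0# ≤ 1#
  0≤1 = ≤-trans (square-nonneg 1#) (≤-reflexive (*-identityˡ 1#))

  0≤n·1 : ∀ n → 0# ≤ n · 1#
  0≤n·1 zero    = ≤-refl
  0≤n·1 (suc n) = +-nonneg 0≤1 (0≤n·1 n)

  -- Some `n · 1#` exceeds 0 by the Archimedean axiom; cotransitivity at 1 either gives the claim or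
  -- lowers `n` by one.
  0<1 : 0# < 1#
  0<1 with archimedean 0#
  ... | zero  , 0<0 = ⊥-elim (<-irrefl refl 0<0)
  ... | suc n , 0<n = ≤-<-trans-1 n 0<n
    where
    ≤-<-trans-1 : ∀ n → 0# < suc n · 1# → 0# < 1#
    ≤-<-trans-1 zero    0<1+0 = <-respʳ-≈ (+-identityʳ 1#) 0<1+0
    ≤-<-trans-1 (suc n) 0<n with <-cotransitive 0<n 1#
    ... | inj₁ 0<1 = 0<1
    ... | inj₂ 1<n = ≤-<-trans-1 n (<-respʳ-≈
            (solve 2 (λ u v → (u :+ v) :- u := v) refl 1# (suc n · 1#)) (x<y⇒0<y-x 1<n))

  n·1-mono-≤ : ∀ {m n} → m ℕ.≤ n → m · 1# ≤ n · 1#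
  n·1-mono-≤ {n = n} ℕ.z≤n     = 0≤n·1 n
  n·1-mono-≤ (ℕ.s≤s m≤n) = +-mono-≤ ≤-refl (n·1-mono-≤ m≤n)

  0<n·1 : ∀ n → 0# < suc n · 1#
  0<n·1 n = <-≤-trans 0<1 (≤-trans (≤-reflexive (sym (+-identityʳ 1#))) (+-mono-≤ ≤-refl (0≤n·1 n)))

  n·x≈n·1*x : ∀ n x → n · x ≈ n · 1# * x
  n·x≈n·1*x n x = sym (trans (×-assoc-* n 1# x) (×-congʳ n (*-identityˡ x)))

  x≤∨ : ∀ x y → x ≤ x ∨ y
  x≤∨ x y = proj₁ (∨-supremum x y)

  y≤∨ : ∀ x y → y ≤ x ∨ y
  y≤∨ x y = proj₁ (proj₂ (∨-supremum x y))

  ∨-least : x ≤ z → y ≤ z → x ∨ y ≤ z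
  ∨-least {x} {z} {y} = proj₂ (proj₂ (∨-supremum x y)) z

  -- Absolute values.

  infix 9 ∣_∣
  ∣_∣ : Carrier → Carrier
  ∣ x ∣ = x ∨ - x

  x≤∣x∣ : ∀ x → x ≤ ∣ x ∣
  x≤∣x∣ x = x≤∨ x (- x)

  -x≤∣x∣ : ∀ x → - x ≤ ∣ x ∣
  -x≤∣x∣ x = y≤∨ x (- x)

  ∣x∣≤ : x ≤ y → - x ≤ y → ∣ x ∣ ≤ y
  ∣x∣≤ = ∨-least

  0≤∣x∣ : ∀ x → 0# ≤ ∣ x ∣
  0≤∣x∣ x = ≤-by-cases 0# x (λ 0≤x → ≤-trans 0≤x (x≤∣x∣ x))
    λ x≤0 → ≤-trans (≤-trans (x≤y⇒0≤y-x x≤0) (≤-reflexive (+-identityˡ (- x)))) (-x≤∣x∣ x)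

  ∣∣-monoˡ : x ≈ y → ∣ x ∣ ≤ ∣ y ∣
  ∣∣-monoˡ eq = ∣x∣≤ (≤-trans (≤-reflexive eq) (x≤∣x∣ _)) (≤-trans (≤-reflexive (-‿cong eq)) (-x≤∣x∣ _))

  ∣0∣≤0 : ∣ 0# ∣ ≤ 0#
  ∣0∣≤0 = ∣x∣≤ ≤-refl (≤-reflexive (solve 0 (:- :0 := :0) refl))

  ∣x+y∣≤∣x∣+∣y∣ : ∀ x y → ∣ x + y ∣ ≤ ∣ x ∣ + ∣ y ∣
  ∣x+y∣≤∣x∣+∣y∣ x y = ∣x∣≤ (+-mono-≤ (x≤∣x∣ x) (x≤∣x∣ y))
    (≤-trans (≤-reflexive (solve 2 (λ x y → :- (x :+ y) := :- x :+ :- y) refl x y))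
      (+-mono-≤ (-x≤∣x∣ x) (-x≤∣x∣ y)))

  ∣x*y∣≤x*∣y∣ : 0# ≤ x → ∀ y → ∣ x * y ∣ ≤ x * ∣ y ∣
  ∣x*y∣≤x*∣y∣ {x} 0≤x y = ∣x∣≤ (*-monoˡ-≤ 0≤x (x≤∣x∣ y))
    (≤-trans (≤-reflexive (solve 2 (λ x y → :- (x :* y) := x :* (:- y)) refl x y)) (*-monoˡ-≤ 0≤x (-x≤∣x∣ y)))

  ∣x*y∣≤∣x∣*∣y∣ : ∀ x y → ∣ x * y ∣ ≤ ∣ x ∣ * ∣ y ∣
  ∣x*y∣≤∣x∣*∣y∣ x y = ≤-by-cases 0# x
    (λ 0≤x → ≤-trans (∣x*y∣≤x*∣y∣ 0≤x y) (*-monoʳ-≤ (0≤∣x∣ y) (x≤∣x∣ x)))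
    λ x≤0 → ≤-trans (∣∣-monoˡ (solve 2 (λ x y → x :* y := (:0 :- x) :* (:- y)) refl x y))
      (≤-trans (∣x*y∣≤x*∣y∣ (x≤y⇒0≤y-x x≤0) (- y))
        (≤-trans (*-monoˡ-≤ (x≤y⇒0≤y-x x≤0) (∣x∣≤ (-x≤∣x∣ y)
            (≤-trans (≤-reflexive (solve 1 (λ y → :- (:- y) := y) refl y)) (x≤∣x∣ y))))
          (*-monoʳ-≤ (0≤∣x∣ y) (≤-trans (≤-reflexive (+-identityˡ (- x))) (-x≤∣x∣ x)))))

  -- Finite sums, reciprocals and rounding.

  sum-mono-≤ : {f g : Fin n → Carrier} → (∀ i → f i ≤ g i) → sum f ≤ sum g
  sum-mono-≤ {zero}  f≤g = ≤-refl
  sum-mono-≤ {suc n} f≤g = +-mono-≤ (f≤g zero) (sum-mono-≤ (f≤g ∘ suc))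

  sum-nonneg : {f : Fin n → Carrier} → (∀ i → 0# ≤ f i) → 0# ≤ sum f
  sum-nonneg {zero}  0≤f = ≤-refl
  sum-nonneg {suc n} 0≤f = +-nonneg (0≤f zero) (sum-nonneg (0≤f ∘ suc))

  term≤sum : {f : Fin n → Carrier} → (∀ i → 0# ≤ f i) → ∀ i → f i ≤ sum f
  term≤sum 0≤f zero    = ≤-trans (≤-reflexive (sym (+-identityʳ _)))
    (+-mono-≤ ≤-refl (sum-nonneg (0≤f ∘ suc)))
  term≤sum 0≤f (suc i) = ≤-trans (term≤sum (0≤f ∘ suc) i)
    (≤-trans (≤-reflexive (sym (+-identityˡ _))) (+-mono-≤ (0≤f zero) ≤-refl))

  ∣sum∣≤sum∣∣ : (f : Fin n → Carrier) → ∣ sum f ∣ ≤ sum (λ i → ∣ f i ∣)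
  ∣sum∣≤sum∣∣ {zero}  f = ∣0∣≤0
  ∣sum∣≤sum∣∣ {suc n} f = ≤-trans (∣x+y∣≤∣x∣+∣y∣ _ _) (+-mono-≤ ≤-refl (∣sum∣≤sum∣∣ (f ∘ suc)))

  sum-distrib-- : (f g : Fin n → Carrier) → sum (λ i → f i - g i) ≈ sum f - sum g
  sum-distrib-- {zero}  f g = solve 0 (:0 := :0 :- :0) refl
  sum-distrib-- {suc n} f g = trans (+-congˡ (sum-distrib-- (f ∘ suc) (g ∘ suc)))
    (solve 4 (λ a b c d → (a :- b) :+ (c :- d) := (a :+ c) :- (b :+ d)) refl
      (f zero) (g zero) (sum (f ∘ suc)) (sum (g ∘ suc)))

  sum-const : ∀ n x → sum {n} (λ _ → x) ≈ n · x
  sum-const zero    x = refl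
  sum-const (suc n) x = +-congˡ (sum-const n x)

  -- Junk value: the reciprocal of 0 is 0.
  1/ : ℕ → Carrier
  1/ zero    = 0#
  1/ (suc n) = divide 1# (suc n · 1#) (0<n·1 n)

  divide*≈ : ∀ x {y} (0<y : 0# < y) → divide x y 0<y * y ≈ x
  divide*≈ x {y} 0<y = trans (*-assoc x _ y) (trans (*-congˡ
      (trans (*-congˡ (solve 1 (λ y → y := y :- :0) refl y))
        (proj₁ (proj₂ (#⇒invertible {y} {0#} (inj₂ 0<y))))))
    (*-identityʳ x))

  n*1/n : ∀ n → suc n · 1# * 1/ (suc n) ≈ 1#
  n*1/n n = trans (*-comm _ _) (divide*≈ 1# (0<n·1 n))

  divide-nonneg : 0# ≤ x → (0<y : 0# < y) → 0# ≤ divide x y 0<y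
  divide-nonneg {x} {y} 0≤x 0<y = *-cancelʳ-≤ 0<y
    (≤-trans (≤-reflexive (zeroˡ y)) (≤-trans 0≤x (≤-reflexive (sym (divide*≈ x 0<y)))))

  0≤1/ : ∀ n → 0# ≤ 1/ n
  0≤1/ zero    = ≤-refl
  0≤1/ (suc n) = divide-nonneg 0≤1 (0<n·1 n)

  1/-antitone : ∀ {m n} → suc m ℕ.≤ n → 1/ n ≤ 1/ (suc m)
  1/-antitone {m} {suc n} m≤n = *-cancelʳ-≤ (0<n·1 n) (begin
    1/ (suc n) * suc n · 1#                          ≈⟨ divide*≈ 1# (0<n·1 n) ⟩
    1#                                               ≈⟨ divide*≈ 1# (0<n·1 m) ⟨
    1/ (suc m) * suc m · 1#                          ≤⟨ *-monoˡ-≤ (0≤1/ (suc m)) (n·1-mono-≤ m≤n) ⟩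
    1/ (suc m) * suc n · 1#                          ∎)
    where open ≤-Reasoning

  -- Stated for the positive part of `x`, the form in which the approachability bound arrives. If
  -- `y < x` then `x` is positive and so is `(x - y) * (x + y)`.
  square-cancel-≤ : 0# ≤ y → (x ∨ 0#) * (x ∨ 0#) ≤ y * y → x ≤ y
  square-cancel-≤ {y} {x} 0≤y xx≤yy y<x = xx≤yy (<-≤-trans
    (0<y-x⇒x<y (<-respʳ-≈ (solve 2 (λ x y → (x :- y) :* (x :+ y) := x :* x :- y :* y) refl x y)
      (*-pos (x<y⇒0<y-x y<x) (<-≤-trans 0<x (≤-gap (solve 2 (λ x y → (x :+ y) :- x := y) refl x y) 0≤y)))))
    (≤-trans (*-monoˡ-≤ (<⇒≤ 0<x) (x≤∨ x 0#)) (*-monoʳ-≤ (≤-trans (<⇒≤ 0<x) (x≤∨ x 0#)) (x≤∨ x 0#))))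
    where
    0<x : 0# < x
    0<x = ≤-<-trans 0≤y y<x

  -- Exact ceilings would need a decidable order. Cotransitivity between `n - 1` and `n` decides
  -- whether to stop or to descend, at the price of a slack of 2.
  natural-above : ∀ x → 0# ≤ x → ∃[ n ] (x ≤ n · 1#) × (n · 1# ≤ x + 2 · 1#)
  natural-above x 0≤x with archimedean x
  ... | n , x<n = descend n x<n
    where
    descend : ∀ n → x < n · 1# → ∃[ n ] (x ≤ n · 1#) × (n · 1# ≤ x + 2 · 1#)
    descend zero    x<0 = ⊥-elim (0≤x x<0)
    descend (suc n) x<n with <-cotransitive {n · 1# - 1#} {n · 1#} (0<y-x⇒x<y (<-respʳ-≈
                               (solve 2 (λ u v → u := v :- (v :- u)) refl 1# (n · 1#)) 0<1)) x
    ... | inj₁ n-1<x = suc n , <⇒≤ x<n , ≤-gap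
            (solve 2 (λ x v → x :+ 2 :× :1 :- (:1 :+ v) := x :- (v :- :1)) refl x (n · 1#))
            (x≤y⇒0≤y-x (<⇒≤ n-1<x))
    ... | inj₂ x<n-1 = descend n x<n-1

  x*∣y∣≤∣x*y∣ : 0# ≤ x → ∀ y → x * ∣ y ∣ ≤ ∣ x * y ∣
  x*∣y∣≤∣x*y∣ {x} 0≤x y = ≤-by-cases 0# y
    (λ 0≤y → ≤-trans (*-monoˡ-≤ 0≤x (∣x∣≤ ≤-refl (≤-trans (≤-trans (neg-mono-≤ 0≤y)
        (≤-reflexive (solve 0 (:- :0 := :0) refl))) 0≤y))) (x≤∣x∣ (x * y)))
    λ y≤0 → ≤-trans (*-monoˡ-≤ 0≤x (∣x∣≤ (≤-trans y≤0 (0≤-y y≤0)) ≤-refl))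
      (≤-trans (≤-reflexive (solve 2 (λ x y → x :* (:- y) := :- (x :* y)) refl x y)) (-x≤∣x∣ (x * y)))
    where
    0≤-y : y ≤ 0# → 0# ≤ - y
    0≤-y y≤0 = ≤-trans (x≤y⇒0≤y-x y≤0) (≤-reflexive (+-identityˡ (- y)))

  -- Splits a signed edge amount into nonnegative amounts for the two directions of the edge.
  positive-negative-difference : ∀ x → (x ∨ 0#) - (- x ∨ 0#) ≈ x
  positive-negative-difference x = trans (+-congʳ (≤-antisym
      (∨-least (≤-gap (solve 2 (λ x n → (x :+ n) :- x := n) refl x (- x ∨ 0#)) (y≤∨ (- x) 0#))
        (≤-gap (solve 2 (λ x n → (x :+ n) :- :0 := n :- (:- x)) refl x (- x ∨ 0#))
          (x≤y⇒0≤y-x (x≤∨ (- x) 0#))))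
      (≤-gap (solve 3 (λ x n p → p :- (x :+ n) := (p :- x) :- n) refl x (- x ∨ 0#) (x ∨ 0#))
        (x≤y⇒0≤y-x (∨-least (≤-gap (solve 2 (λ x p → (p :- x) :- (:- x) := p) refl x (x ∨ 0#)) (y≤∨ x 0#))
          (x≤y⇒0≤y-x (x≤∨ x 0#)))))))
    (solve 2 (λ x n → (x :+ n) :- n := x) refl x (- x ∨ 0#))

  positive+negative≤∣x∣ : ∀ x → (x ∨ 0#) + (- x ∨ 0#) ≤ ∣ x ∣
  positive+negative≤∣x∣ x = ≤-by-cases 0# x
    (λ 0≤x → ≤-trans (+-mono-≤ (∨-least (x≤∣x∣ x) (0≤∣x∣ x))
        (∨-least (≤-trans (neg-mono-≤ 0≤x) (≤-reflexive neg-0)) ≤-refl)) (≤-reflexive (+-identityʳ _)))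
    λ x≤0 → ≤-trans (+-mono-≤ (∨-least x≤0 ≤-refl) (∨-least (-x≤∣x∣ x) (0≤∣x∣ x)))
      (≤-reflexive (+-identityˡ _))
    where
    neg-0 : - 0# ≈ 0#
    neg-0 = solve 0 (:- :0 := :0) refl

  ∣x-y∣≤x+y : 0# ≤ x → 0# ≤ y → ∣ x - y ∣ ≤ x + y
  ∣x-y∣≤x+y {x} {y} 0≤x 0≤y = ∣x∣≤
    (≤-gap (solve 2 (λ x y → (x :+ y) :- (x :- y) := y :+ y) refl x y) (+-nonneg 0≤y 0≤y))
    (≤-gap (solve 2 (λ x y → (x :+ y) :- (:- (x :- y)) := x :+ x) refl x y) (+-nonneg 0≤x 0≤x))

  sum-δ : ∀ (i : Fin n) (f : Fin n → Carrier) → sum (λ j → (if does (i ≟ j) then 1# else 0#) * f j) ≈ f i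
  sum-δ {suc n} zero f = trans (+-cong (*-identityˡ _)
      (trans (sum-cong-≋ (λ j → zeroˡ (f (suc j)))) (sum-replicate-zero n)))
    (+-identityʳ _)
  sum-δ (suc i) f = trans (+-cong (zeroˡ _) (sum-δ i (f ∘ suc))) (+-identityˡ _)

-- Oblivious schemes from matrices of signed edge amounts.

module Certificates {R : Reals} (G : Network R) where
  open RealArithmetic R
  open Network G
  open Flow
  open IsFlow

  src dst : Fin ∣E∣ → Fin ∣V∣
  src e = proj₁ (ends e)
  dst e = proj₂ (ends e)

  δ : Fin ∣V∣ → Fin ∣V∣ → Carrier
  δ = [_≡?_] G

  -- The boundary operator with respect to the reference orientations; `netOut G f` is `∂` of the
  -- difference of `fwd f` and `bwd f`.
  ∂ : (Fin ∣E∣ → Carrier) → Fin ∣V∣ → Carrier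
  ∂ x v = sum λ e → (δ (src e) v - δ (dst e) v) * x e

  ∂-cong : ∀ {x y} → (∀ e → x e ≈ y e) → ∀ v → ∂ x v ≈ ∂ y v
  ∂-cong x≈y v = sum-cong-≋ λ e → *-congˡ (x≈y e)

  -- Boundary and potential difference are adjoint: after exchanging the sums, the deltas select the
  -- endpoints of each edge.
  summation-by-parts : ∀ (φ : Fin ∣V∣ → Carrier) x →
    sum (λ v → ∂ x v * φ v) ≈ sum (λ e → (φ (src e) - φ (dst e)) * x e)
  summation-by-parts φ x = begin
    sum (λ v → ∂ x v * φ v)
      ≈⟨ sum-cong-≋ (λ v → *-distribʳ-sum (φ v) (λ e → (δ (src e) v - δ (dst e) v) * x e)) ⟩
    sum (λ v → sum λ e → (δ (src e) v - δ (dst e) v) * x e * φ v)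
      ≈⟨ ∑-comm (λ v e → (δ (src e) v - δ (dst e) v) * x e * φ v) ⟩
    sum (λ e → sum λ v → (δ (src e) v - δ (dst e) v) * x e * φ v)
      ≈⟨ sum-cong-≋ per-edge ⟩
    sum (λ e → (φ (src e) - φ (dst e)) * x e) ∎
    where
    open Relation.Binary.Reasoning.Setoid setoid
    per-edge : ∀ e → sum (λ v → (δ (src e) v - δ (dst e) v) * x e * φ v) ≈ (φ (src e) - φ (dst e)) * x e
    per-edge e = begin
      sum (λ v → (δ (src e) v - δ (dst e) v) * x e * φ v)
        ≈⟨ sum-cong-≋ (λ v → solve 4 (λ a b x p → (a :- b) :* x :* p := (a :* p :- b :* p) :* x) refl
             (δ (src e) v) (δ (dst e) v) (x e) (φ v)) ⟩
      sum (λ v → (δ (src e) v * φ v - δ (dst e) v * φ v) * x e)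
        ≈⟨ *-distribʳ-sum (x e) (λ v → δ (src e) v * φ v - δ (dst e) v * φ v) ⟨
      sum (λ v → δ (src e) v * φ v - δ (dst e) v * φ v) * x e
        ≈⟨ *-congʳ (sum-distrib-- (λ v → δ (src e) v * φ v) (λ v → δ (dst e) v * φ v)) ⟩
      (sum (λ v → δ (src e) v * φ v) - sum (λ v → δ (dst e) v * φ v)) * x e
        ≈⟨ *-congʳ (+-cong (sum-δ (src e) φ) (-‿cong (sum-δ (dst e) φ))) ⟩
      (φ (src e) - φ (dst e)) * x e ∎

  -- Pairing the boundary of the flow with `φ` gives `d * (φ s - φ t)`. Summation by parts
  -- distributes this over the edges, where the net amount is at most the gross amount.
  potential-bound : ∀ {s t d f} → 0# ≤ d → IsFlow G s t d f → ∀ (φ : Fin ∣V∣ → Carrier) →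
    d * ∣ φ s - φ t ∣ ≤ sum (λ e → ∣ φ (src e) - φ (dst e) ∣ * (fwd f e + bwd f e))
  potential-bound {s} {t} {d} {f} 0≤d isFlow φ = begin
    d * ∣ φ s - φ t ∣
      ≤⟨ x*∣y∣≤∣x*y∣ 0≤d (φ s - φ t) ⟩
    ∣ d * (φ s - φ t) ∣
      ≤⟨ ∣∣-monoˡ (trans (sym net) (summation-by-parts φ x)) ⟩
    ∣ sum (λ e → (φ (src e) - φ (dst e)) * x e) ∣
      ≤⟨ ∣sum∣≤sum∣∣ (λ e → (φ (src e) - φ (dst e)) * x e) ⟩
    sum (λ e → ∣ (φ (src e) - φ (dst e)) * x e ∣)
      ≤⟨ sum-mono-≤ (λ e → ≤-trans (∣x*y∣≤∣x∣*∣y∣ (φ (src e) - φ (dst e)) (x e))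
           (*-monoˡ-≤ (0≤∣x∣ _) (∣x-y∣≤x+y (fwd-nonneg isFlow e) (bwd-nonneg isFlow e)))) ⟩
    sum (λ e → ∣ φ (src e) - φ (dst e) ∣ * (fwd f e + bwd f e)) ∎
    where
    open ≤-Reasoning
    x : Fin ∣E∣ → Carrier
    x e = fwd f e - bwd f e
    net : sum (λ v → ∂ x v * φ v) ≈ d * (φ s - φ t)
    net = trans (sum-cong-≋ λ v → trans (*-congʳ (conservation isFlow v))
        (solve 4 (λ d a b p → d :* (a :- b) :* p := d :* (a :* p :- b :* p)) refl d (δ s v) (δ t v) (φ v)))
      (trans (sym (*-distribˡ-sum d (λ v → δ s v * φ v - δ t v * φ v)))
        (*-congˡ (trans (sum-distrib-- (λ v → δ s v * φ v) (λ v → δ t v * φ v))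
          (+-cong (sum-δ s φ) (-‿cong (sum-δ t φ))))))

  foldr-∨-least : ∀ {n b} {f : Fin n → Carrier} → 0# ≤ b → (∀ i → f i ≤ b) → foldr _∨_ 0# f ≤ b
  foldr-∨-least {zero}  0≤b f≤b = 0≤b
  foldr-∨-least {suc n} 0≤b f≤b = ∨-least (f≤b zero) (foldr-∨-least 0≤b (f≤b ∘ suc))

  0≤foldr-∨ : ∀ {n} (f : Fin n → Carrier) → 0# ≤ foldr _∨_ 0# f
  0≤foldr-∨ {zero}  f = ≤-refl
  0≤foldr-∨ {suc n} f = ≤-trans (0≤foldr-∨ (f ∘ suc)) (y≤∨ _ _)

  ≤foldr-∨ : ∀ {n} (f : Fin n → Carrier) i → f i ≤ foldr _∨_ 0# f
  ≤foldr-∨ f zero    = x≤∨ _ _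
  ≤foldr-∨ f (suc i) = ≤-trans (≤foldr-∨ (f ∘ suc) i) (y≤∨ _ _)

  -- The amount on `h` when a unit on edge `e` is rerouted along `M (src e) - M (dst e)`.
  stretch : (Fin ∣V∣ → Fin ∣E∣ → Carrier) → Fin ∣E∣ → Fin ∣E∣ → Carrier
  stretch M e h = ∣ M (src e) h - M (dst e) h ∣

  module _ {k : ℕ} (K : Fin k ↣ Fin ∣V∣) where
    open Injection K using (to)

    -- Only differences of rows are constrained, so the rows of one component may share any common
    -- error in their boundaries.
    RoutesTerminals : (Fin ∣V∣ → Fin ∣E∣ → Carrier) → Set
    RoutesTerminals M = ∀ s t → Connected (to s) (to t) → ∀ v →
      ∂ (λ e → M (to s) e - M (to t) e) v ≈ δ (to s) v - δ (to t) v

    -- `congested` concerns one extreme load: every edge `e` filled to `cap e` and rerouted by `M`.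
    -- Up to scaling by its congestion, every multiflow is dominated by this load.
    module LinearScheme (α : Carrier) (0≤α : 0# ≤ α) (M : Fin ∣V∣ → Fin ∣E∣ → Carrier)
      (routes : RoutesTerminals M)
      (congested : ∀ h → sum (λ e → stretch M e h * cap e) ≤ α * cap h) where

      linearScheme : ObliviousScheme G K
      linearScheme = record
        { flow = λ s t → record
            { fwd = λ e → (M (to s) e - M (to t) e) ∨ 0#
            ; bwd = λ e → - (M (to s) e - M (to t) e) ∨ 0# }
        ; unit = λ s t conn → record
            { fwd-nonneg   = λ e → y≤∨ _ _
            ; bwd-nonneg   = λ e → y≤∨ _ _
            ; conservation = λ v → trans
                (∂-cong (λ e → positive-negative-difference (M (to s) e - M (to t) e)) v)
                (trans (routes s t conn v) (sym (*-identityˡ _))) } }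

      linearScheme-oblivious : IsOblivious G K α linearScheme
      linearScheme-oblivious D 0≤D F routesD = foldr-∨-least (*-nonneg 0≤α 0≤cong) λ h →
        *-cancelʳ-≤ (cap-pos h) (≤-trans (≤-reflexive (divide*≈ _ (cap-pos h))) (load-bound h))
        where
        open ≤-Reasoning
        cong = congestion G K F
        0≤cong : 0# ≤ cong
        0≤cong = 0≤foldr-∨ λ e → divide (load G K F e) (cap e) (cap-pos e)
        g : ∀ s t e → Carrier
        g s t e = fwd (F s t) e + bwd (F s t) e
        load≤ : ∀ e → load G K F e ≤ cap e * cong
        load≤ e = ≤-trans (≤-reflexive (trans (sym (divide*≈ _ (cap-pos e))) (*-comm _ _)))
          (*-monoˡ-≤ (<⇒≤ (cap-pos e)) (≤foldr-∨ (λ e → divide (load G K F e) (cap e) (cap-pos e)) e))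
        -- With column `h` of `M` as potential, the load that the pair `s`, `t` puts on `h` is
        -- charged to the edges that `F` uses for this pair.
        pair : ∀ h s t → D s t * ((M (to s) h - M (to t) h) ∨ 0#) + D s t * (- (M (to s) h - M (to t) h) ∨ 0#)
                       ≤ sum (λ e → stretch M e h * g s t e)
        pair h s t = ≤-trans (≤-reflexive (sym (distribˡ _ _ _)))
          (≤-trans (*-monoˡ-≤ (0≤D s t) (positive+negative≤∣x∣ _))
            (potential-bound (0≤D s t) (routesD s t) (λ v → M v h)))
        load-bound : ∀ h → load G K (ObliviousScheme.routing linearScheme D) h ≤ α * cong * cap h
        load-bound h = begin
          load G K (ObliviousScheme.routing linearScheme D) h
            ≤⟨ sum-mono-≤ (λ s → sum-mono-≤ (pair h s)) ⟩
          sum (λ s → sum λ t → sum λ e → stretch M e h * g s t e)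
            ≈⟨ sum-cong-≋ (λ s → ∑-comm (λ t e → stretch M e h * g s t e)) ⟩
          sum (λ s → sum λ e → sum λ t → stretch M e h * g s t e)
            ≈⟨ ∑-comm (λ s e → sum λ t → stretch M e h * g s t e) ⟩
          sum (λ e → sum λ s → sum λ t → stretch M e h * g s t e)
            ≈⟨ sum-cong-≋ (λ e → trans (*-distribˡ-sum (stretch M e h) (λ s → sum (g′ e s)))
                 (sum-cong-≋ λ s → *-distribˡ-sum (stretch M e h) (g′ e s))) ⟨
          sum (λ e → stretch M e h * load G K F e)
            ≤⟨ sum-mono-≤ (λ e → *-monoˡ-≤ (0≤∣x∣ _) (load≤ e)) ⟩
          sum (λ e → stretch M e h * (cap e * cong))
            ≈⟨ sum-cong-≋ (λ e → *-assoc (stretch M e h) (cap e) cong) ⟨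
          sum (λ e → stretch M e h * cap e * cong)
            ≈⟨ *-distribʳ-sum cong (λ e → stretch M e h * cap e) ⟨
          sum (λ e → stretch M e h * cap e) * cong
            ≤⟨ *-monoʳ-≤ 0≤cong (congested h) ⟩
          α * cap h * cong
            ≈⟨ solve 3 (λ a c k → a :* c :* k := a :* k :* c) refl α (cap h) cong ⟩
          α * cong * cap h ∎
          where
          g′ : ∀ e s t → Carrier
          g′ e s t = g s t e

-- Truncated subtraction, common bounds and connected components.

<∸⇒+< : ∀ a b r → a ℕ.< r ℕ.∸ b → b ℕ.+ a ℕ.< r
<∸⇒+< a zero    r       a<r = a<r
<∸⇒+< a (suc b) (suc r) a<r = ℕ.s≤s (<∸⇒+< a b r a<r)

+<⇒<∸ : ∀ a b r → b ℕ.+ a ℕ.< r → a ℕ.< r ℕ.∸ b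
+<⇒<∸ a zero    r       a<r         = a<r
+<⇒<∸ a (suc b) (suc r) (ℕ.s≤s a<r) = +<⇒<∸ a b r a<r

upperBound : ∀ {n} (f : Fin n → ℕ) → ∃[ B ] ∀ i → f i ℕ.≤ B
upperBound {zero}  f = 0 , λ ()
upperBound {suc n} f with upperBound (f ∘ suc)
... | B , f≤B = f zero ℕ.+ B , λ
  { zero    → ℕ.m≤m+n (f zero) B
  ; (suc i) → ℕ.≤-trans (f≤B i) (ℕ.m≤n+m B (f zero)) }

-- The pairs are processed one by one, each merging the classes of its two ends. With walks for `W`,
-- connectedness becomes equality of representatives, and every vertex receives an explicit walk to
-- its representative.
components : ∀ {n} {W : Fin n → Fin n → Set} → Reflexive W → Symmetric W → Transitive W →
  ∀ {m} (f : Fin m → Fin n × Fin n) → (∀ i → W (proj₁ (f i)) (proj₂ (f i))) →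
  Σ (Fin n → Fin n) λ root → (∀ i → root (proj₁ (f i)) ≡ root (proj₂ (f i))) × (∀ v → W v (root v))
components {n} rfl _ _ {zero} f _ = (λ v → v) , (λ ()) , λ v → rfl
components {n} {W} rfl symm trns {suc m} f f⊆W with components {W = W} rfl symm trns (f ∘ suc) (f⊆W ∘ suc)
... | root , root-≡ , to-root = merge ∘ root , merged , λ v → trns (to-root v) (to-merge (root v))
  where
  a b : Fin n
  a = root (proj₁ (f zero))
  b = root (proj₂ (f zero))

  merge : Fin n → Fin n
  merge v with v ≟ b
  ... | yes _ = a
  ... | no  _ = v

  to-merge : ∀ v → W v (merge v)
  to-merge v with v ≟ b
  ... | yes ≡.refl = trns (symm (to-root _)) (trns (symm (f⊆W zero)) (to-root _))
  ... | no  _      = rfl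

  merge-a : merge a ≡ a
  merge-a with a ≟ b
  ... | yes _ = ≡.refl
  ... | no  _ = ≡.refl

  merge-b : merge b ≡ a
  merge-b with b ≟ b
  ... | yes _   = ≡.refl
  ... | no  b≢b = ⊥-elim (b≢b ≡.refl)

  merged : ∀ i → merge (root (proj₁ (f i))) ≡ merge (root (proj₂ (f i)))
  merged zero    = ≡.trans merge-a (≡.sym merge-b)
  merged (suc i) = ≡.cong merge (root-≡ i)

-- Walks and distances for integral edge lengths.

module Walks {R : Reals} (G : Network R)
  (y : Fin (Network.∣E∣ G) → ℕ) (1≤y : ∀ e → 1 ℕ.≤ y e) where
  open Network G

  private
    src dst : Fin ∣E∣ → Fin ∣V∣
    src e = proj₁ (ends e)
    dst e = proj₂ (ends e)

  data Walk : Fin ∣V∣ → Fin ∣V∣ → Set where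
    []    : ∀ {u} → Walk u u
    forth : ∀ e {v} → Walk (dst e) v → Walk (src e) v
    back  : ∀ e {v} → Walk (src e) v → Walk (dst e) v

  length : ∀ {u v} → Walk u v → ℕ
  length []          = 0
  length (forth e w) = y e ℕ.+ length w
  length (back e w)  = y e ℕ.+ length w

  infixr 5 _++_
  _++_ : ∀ {u v w} → Walk u v → Walk v w → Walk u w
  []        ++ q = q
  forth e p ++ q = forth e (p ++ q)
  back e p  ++ q = back e (p ++ q)

  length-++ : ∀ {u v w} (p : Walk u v) (q : Walk v w) → length (p ++ q) ≡ length p ℕ.+ length q
  length-++ []          q = ≡.refl
  length-++ (forth e p) q = ≡.trans (≡.cong (y e ℕ.+_) (length-++ p q)) (≡.sym (ℕ.+-assoc (y e) _ _))
  length-++ (back e p)  q = ≡.trans (≡.cong (y e ℕ.+_) (length-++ p q)) (≡.sym (ℕ.+-assoc (y e) _ _))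

  reverse : ∀ {u v} → Walk u v → Walk v u
  reverse []          = []
  reverse (forth e p) = reverse p ++ back e []
  reverse (back e p)  = reverse p ++ forth e []

  length-reverse : ∀ {u v} (p : Walk u v) → length (reverse p) ≡ length p
  length-reverse []          = ≡.refl
  length-reverse (forth e p) = ≡.trans (length-++ (reverse p) (back e []))
    (≡.trans (ℕ.+-comm (length (reverse p)) _) (≡.cong₂ ℕ._+_ (ℕ.+-identityʳ (y e)) (length-reverse p)))
  length-reverse (back e p)  = ≡.trans (length-++ (reverse p) (forth e []))
    (≡.trans (ℕ.+-comm (length (reverse p)) _) (≡.cong₂ ℕ._+_ (ℕ.+-identityʳ (y e)) (length-reverse p)))

  -- The bound is strict: nothing lies within radius 0 and, all lengths being positive, only `u`
  -- lies within radius 1.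
  Near : ℕ → Fin ∣V∣ → Fin ∣V∣ → Set
  Near r u v = Σ (Walk u v) λ p → length p ℕ.< r

  Near-trans : ∀ {r s u v w} → Near r u v → Near s v w → Near (r ℕ.+ s) u w
  Near-trans (p , p<r) (q , q<s) = p ++ q ,
    ≡.subst (ℕ._< _) (≡.sym (length-++ p q)) (ℕ.+-mono-< p<r q<s)

  Near-sym : ∀ {r u v} → Near r u v → Near r v u
  Near-sym (p , p<r) = reverse p , ≡.subst (ℕ._< _) (≡.sym (length-reverse p)) p<r

  Near-mono : ∀ {r s u v} → r ℕ.≤ s → Near r u v → Near s u v
  Near-mono r≤s (p , p<r) = p , ℕ.<-≤-trans p<r r≤s

  Near-refl : ∀ {r u} → Near (suc r) u u
  Near-refl = [] , ℕ.s≤s ℕ.z≤n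

  Near-1⇒≡ : ∀ {u v} → Near 1 u v → u ≡ v
  Near-1⇒≡ ([] , _) = ≡.refl
  Near-1⇒≡ (forth e p , ℕ.s≤s le) with y e | 1≤y e
  Near-1⇒≡ (forth e p , ℕ.s≤s ()) | suc _ | _
  Near-1⇒≡ (back e p , ℕ.s≤s le) with y e | 1≤y e
  Near-1⇒≡ (back e p , ℕ.s≤s ()) | suc _ | _

  Near-dst⇒src : ∀ {r t} e → Near r (dst e) t → Near (y e ℕ.+ r) (src e) t
  Near-dst⇒src e (p , p<r) = forth e p , ℕ.+-monoʳ-< (y e) p<r

  Near-src⇒dst-∸ : ∀ {r t} e → Near (r ℕ.∸ y e) (src e) t → Near r (dst e) t
  Near-src⇒dst-∸ e (p , p<r) = back e p , <∸⇒+< _ (y e) _ p<r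

  private
    FirstStep : ℕ → Fin ∣V∣ → Fin ∣V∣ → Set
    FirstStep r u v = (0 ℕ.< r × u ≡ v)
      ⊎ (∃[ e ] (src e ≡ u × Near (r ℕ.∸ y e) (dst e) v))
      ⊎ (∃[ e ] (dst e ≡ u × Near (r ℕ.∸ y e) (src e) v))

    firstStep : ∀ {r u v} → Near r u v → FirstStep r u v
    firstStep ([] , 0<r)          = inj₁ (0<r , ≡.refl)
    firstStep (forth e p , p<r)   = inj₂ (inj₁ (e , ≡.refl , p , +<⇒<∸ _ (y e) _ p<r))
    firstStep (back e p , p<r)    = inj₂ (inj₂ (e , ≡.refl , p , +<⇒<∸ _ (y e) _ p<r))

    unstep : ∀ {r u v} → FirstStep r u v → Near r u v
    unstep (inj₁ (0<r , ≡.refl))                   = [] , 0<r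
    unstep (inj₂ (inj₁ (e , ≡.refl , p , p<r∸y)))  = forth e p , <∸⇒+< _ (y e) _ p<r∸y
    unstep (inj₂ (inj₂ (e , ≡.refl , p , p<r∸y)))  = back e p , <∸⇒+< _ (y e) _ p<r∸y

    r∸y<r : ∀ r e → suc r ℕ.∸ y e ℕ.< suc r
    r∸y<r r e with y e | 1≤y e
    ... | suc n | _ = ℕ.s≤s (ℕ.m∸n≤m r n)

    -- Recursion on the radius: after a first edge `e` the radius `r ∸ y e` remains, smaller because
    -- `1 ≤ y e`. Truncation does no harm, since nothing is within radius 0.
    near-acc : ∀ {r} → Acc ℕ._<_ r → ∀ u v → Dec (Near r u v)
    near-acc {zero}  _         u v = no λ { (p , ()) }
    near-acc {suc r} (acc rec) u v = Dec.map′ unstep firstStep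
      ((0 ℕ.<? suc r ×-dec u ≟ v)
        ⊎-dec (any? (λ e → src e ≟ u ×-dec near-acc (rec (r∸y<r r e)) (dst e) v)
        ⊎-dec any? (λ e → dst e ≟ u ×-dec near-acc (rec (r∸y<r r e)) (src e) v)))

  abstract
    near? : ∀ r u v → Dec (Near r u v)
    near? r = near-acc (<-wellFounded r)

  private
    roots = components {W = Walk} [] reverse _++_ ends (λ e → forth e [])

  root : Fin ∣V∣ → Fin ∣V∣
  root = proj₁ roots

  Connected⇒root≡ : ∀ {u v} → Connected u v → root u ≡ root v
  Connected⇒root≡ = Closure.gfold ≡.isEquivalence root λ { (e , ≡.refl) → proj₁ (proj₂ roots) e }

  Walk⇒root≡ : ∀ {u v} → Walk u v → root u ≡ root v
  Walk⇒root≡ []          = ≡.refl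
  Walk⇒root≡ (forth e p) = ≡.trans (proj₁ (proj₂ roots) e) (Walk⇒root≡ p)
  Walk⇒root≡ (back e p)  = ≡.trans (≡.sym (proj₁ (proj₂ roots) e)) (Walk⇒root≡ p)

  private
    to-root : ∀ v → Walk v (root v)
    to-root = proj₂ (proj₂ roots)

    height : ∃[ B ] ∀ v → length (to-root v) ℕ.≤ B
    height = upperBound (λ v → length (to-root v))

  -- A bound for all components at once: one walk to the common root and one back, each shorter than
  -- half of this.
  diameter : ℕ
  diameter = suc (proj₁ height) ℕ.+ suc (proj₁ height)

  root≡⇒Near : ∀ {r u v} → diameter ℕ.≤ r → root u ≡ root v → Near r u v
  root≡⇒Near {r} {u} {v} d≤r eq = Near-mono d≤r (Near-trans
    (≡.subst (Near (suc (proj₁ height)) u) eq (to-root u , ℕ.s≤s (proj₂ height u)))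
    (Near-sym (to-root v , ℕ.s≤s (proj₂ height v))))

  -- From this radius on, a ball is the whole component, hence the same around all of its vertices.
  Near-Connected : ∀ {r u v t} → diameter ℕ.≤ r → Connected u v → Near r u t → Near r v t
  Near-Connected d≤r conn (p , _) =
    root≡⇒Near d≤r (≡.trans (≡.sym (Connected⇒root≡ conn)) (Walk⇒root≡ p))

-- Finite sets, uniform distributions and harmonic numbers.

infix 4 _⊆_
_⊆_ : ∀ {k} → (Fin k → Bool) → (Fin k → Bool) → Set
P ⊆ Q = ∀ i → T (P i) → T (Q i)

count : ∀ {k} → (Fin k → Bool) → ℕ
count {zero}  P = 0
count {suc k} P = (if P zero then 1 else 0) ℕ.+ count (P ∘ suc)

count-mono : ∀ {k} {P Q : Fin k → Bool} → P ⊆ Q → count P ℕ.≤ count Q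
count-mono {zero}  P⊆Q = ℕ.z≤n
count-mono {suc k} {P} {Q} P⊆Q with P zero | Q zero | P⊆Q zero
... | false | _     | _ = ℕ.≤-trans (count-mono (P⊆Q ∘ suc)) (ℕ.m≤n+m _ _)
... | true  | true  | _ = ℕ.s≤s (count-mono (P⊆Q ∘ suc))
... | true  | false | f = ⊥-elim (f _)

count≤ : ∀ {k} (P : Fin k → Bool) → count P ℕ.≤ k
count≤ {zero}  P = ℕ.z≤n
count≤ {suc k} P with P zero
... | true  = ℕ.s≤s (count≤ (P ∘ suc))
... | false = ℕ.m≤n⇒m≤1+n (count≤ (P ∘ suc))

1≤count : ∀ {k} (P : Fin k → Bool) i → T (P i) → 1 ℕ.≤ count P
1≤count P zero Pi with P zero
... | true = ℕ.s≤s ℕ.z≤n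
1≤count P (suc i) Pi = ℕ.≤-trans (1≤count (P ∘ suc) i Pi) (ℕ.m≤n+m _ _)

module UniformDistributions (R : Reals) where
  open RealArithmetic R

  indicator : Bool → Carrier
  indicator b = if b then 1# else 0#

  0≤indicator : ∀ b → 0# ≤ indicator b
  0≤indicator true  = 0≤1
  0≤indicator false = ≤-refl

  sum-indicator : ∀ {k} (P : Fin k → Bool) → sum (indicator ∘ P) ≈ count P · 1#
  sum-indicator {zero}  P = refl
  sum-indicator {suc k} P with P zero
  ... | true  = +-congˡ (sum-indicator (P ∘ suc))
  ... | false = trans (+-identityˡ _) (sum-indicator (P ∘ suc))

  -- For an empty `P` this is the zero vector, and its mass is 0 instead of 1.
  uniform : ∀ {k} → (Fin k → Bool) → Fin k → Carrier
  uniform P i = indicator (P i) * 1/ (count P)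

  0≤uniform : ∀ {k} (P : Fin k → Bool) i → 0# ≤ uniform P i
  0≤uniform P i = *-nonneg (0≤indicator (P i)) (0≤1/ (count P))

  sum-uniform : ∀ {k} (P : Fin k → Bool) → sum (uniform P) ≈ count P · 1# * 1/ (count P)
  sum-uniform P = trans (sym (*-distribʳ-sum (1/ (count P)) (indicator ∘ P))) (*-congʳ (sum-indicator P))

  n*1/n≤1 : ∀ n → n · 1# * 1/ n ≤ 1#
  n*1/n≤1 zero    = ≤-trans (≤-reflexive (zeroˡ _)) 0≤1
  n*1/n≤1 (suc n) = ≤-reflexive (n*1/n n)

  sum-uniform≤1 : ∀ {k} (P : Fin k → Bool) → sum (uniform P) ≤ 1#
  sum-uniform≤1 P = ≤-trans (≤-reflexive (sum-uniform P)) (n*1/n≤1 (count P))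

  sum-uniform≈1 : ∀ {k} (P : Fin k → Bool) i → T (P i) → sum (uniform P) ≈ 1#
  sum-uniform≈1 P i Pi with count P | 1≤count P i Pi | sum-uniform P
  ... | suc n | _ | eq = trans eq (n*1/n n)

  -- The product is 1 for positive numbers and 0 for 0, which makes the mass of a uniform
  -- distribution monotone even when empty sets are allowed.
  n*1/n-mono : ∀ {m n} → m ℕ.≤ n → m · 1# * 1/ m ≤ n · 1# * 1/ n
  n*1/n-mono {zero}  {n}     _   = ≤-trans (≤-reflexive (zeroˡ _)) (*-nonneg (0≤n·1 n) (0≤1/ n))
  n*1/n-mono {suc m} {suc n} _   = ≤-reflexive (trans (n*1/n m) (sym (n*1/n n)))

  -- A point of `A` has mass `1/ (count P)` under `P`, and `P` is no larger than `B`.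
  uniform-lower : ∀ {k} {A P B : Fin k → Bool} → A ⊆ P → P ⊆ B → ∀ i →
    indicator (A i) * 1/ (count B) ≤ uniform P i
  uniform-lower {A = A} {P} {B} A⊆P P⊆B i with A i | A⊆P i
  ... | false | _ = ≤-trans (≤-reflexive (zeroˡ _)) (0≤uniform P i)
  ... | true  | f with P i in eq
  ...   | false = ⊥-elim (f _)
  ...   | true with count P | 1≤count P i (≡.subst T (≡.sym eq) _) | count-mono P⊆B
  ...     | suc p | _ | p≤b = *-monoˡ-≤ 0≤1 (1/-antitone p≤b)

  uniform-cong : ∀ {k} {P Q : Fin k → Bool} → P ⊆ Q → Q ⊆ P → ∀ i → uniform P i ≈ uniform Q i
  uniform-cong {P = P} {Q} P⊆Q Q⊆P i = *-cong
    (indicator-cong (P i) (Q i) (P⊆Q i) (Q⊆P i))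
    (reflexive (≡.cong 1/ (ℕ.≤-antisym (count-mono P⊆Q) (count-mono Q⊆P))))
    where
    indicator-cong : ∀ a b → (T a → T b) → (T b → T a) → indicator a ≈ indicator b
    indicator-cong true  true  _ _ = refl
    indicator-cong false false _ _ = refl
    indicator-cong true  false f _ = ⊥-elim (f _)
    indicator-cong false true  _ f = ⊥-elim (f _)

  harmonic : ℕ → Carrier
  harmonic zero    = 0#
  harmonic (suc n) = harmonic n + 1/ (suc n)

  harmonic-mono : ∀ {m n} → m ℕ.≤ n → harmonic m ≤ harmonic n
  harmonic-mono m≤n = go (ℕ.≤⇒≤′ m≤n)
    where
    go : ∀ {m n} → m ℕ.≤′ n → harmonic m ≤ harmonic n
    go ℕ.≤′-refl                = ≤-refl
    go (ℕ.≤′-step {n = n} m≤n)  = ≤-trans (go m≤n)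
      (≤-gap (solve 2 (λ h i → (h :+ i) :- h := i) refl (harmonic n) (1/ (suc n))) (0≤1/ (suc n)))

  -- The difference consists of `b - a` reciprocals of numbers that are at most `b`, hence at most
  -- `c`.
  harmonic-gap : ∀ {a b c} → a ℕ.≤ b → b ℕ.≤ c →
    (b · 1# - a · 1#) * 1/ c ≤ harmonic b - harmonic a
  harmonic-gap {a} a≤b = go (ℕ.≤⇒≤′ a≤b)
    where
    go : ∀ {b c} → a ℕ.≤′ b → b ℕ.≤ c → (b · 1# - a · 1#) * 1/ c ≤ harmonic b - harmonic a
    go {c = c} ℕ.≤′-refl _ = ≤-reflexive
      (solve 3 (λ a i h → (a :- a) :* i := h :- h) refl (a · 1#) (1/ c) (harmonic a))
    go {c = c} (ℕ.≤′-step {n = n} a≤n) n<c = ≤-trans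
      (≤-reflexive (solve 3 (λ n a i → (:1 :+ n :- a) :* i := (n :- a) :* i :+ i) refl (n · 1#) (a · 1#)
        (1/ c)))
      (≤-trans (+-mono-≤ (go a≤n (ℕ.<⇒≤ n<c)) (1/-antitone n<c))
        (≤-reflexive (solve 3 (λ h a i → (h :- a) :+ i := (h :+ i) :- a) refl (harmonic n) (harmonic a)
          (1/ (suc n)))))

  -- Two uniform distributions on sets between A and B share at least the mass 1/∣B∣ on each point of A.
  uniform-distance : ∀ {k} {A P Q B : Fin k → Bool} → A ⊆ P → A ⊆ Q → P ⊆ B → Q ⊆ B →
    sum (λ i → ∣ uniform P i - uniform Q i ∣) ≤ 2 · (harmonic (count B) - harmonic (count A))
  uniform-distance {k} {A} {P} {Q} {B} A⊆P A⊆Q P⊆B Q⊆B = begin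
    sum (λ i → ∣ uniform P i - uniform Q i ∣)
      ≤⟨ sum-mono-≤ (λ i → pointwise (uniform-lower A⊆P P⊆B i) (uniform-lower A⊆Q Q⊆B i)) ⟩
    sum (λ i → (uniform P i + uniform Q i) - 2 · (indicator (A i) * 1/ b))
      ≈⟨ trans (sum-distrib-- (λ i → uniform P i + uniform Q i) (λ i → 2 · (indicator (A i) * 1/ b)))
           (+-cong (trans (∑-distrib-+ (uniform P) (uniform Q)) (+-cong (sum-uniform P) (sum-uniform Q)))
             (-‿cong (trans (sum-cong-≋ (λ i → n·x≈n·1*x 2 (indicator (A i) * 1/ b)))
               (trans (sym (*-distribˡ-sum (2 · 1#) (λ i → indicator (A i) * 1/ b)))
                 (*-congˡ (trans (sym (*-distribʳ-sum (1/ b) (indicator ∘ A)))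
                   (*-congʳ (sum-indicator A)))))))) ⟩
    (count P · 1# * 1/ (count P) + count Q · 1# * 1/ (count Q)) - 2 · 1# * (a · 1# * 1/ b)
      ≤⟨ +-mono-≤ (+-mono-≤ (n*1/n-mono (count-mono P⊆B)) (n*1/n-mono (count-mono Q⊆B))) ≤-refl ⟩
    (b · 1# * 1/ b + b · 1# * 1/ b) - 2 · 1# * (a · 1# * 1/ b)
      ≈⟨ solve 3 (λ b a i → (b :* i :+ b :* i) :- 2 :× :1 :* (a :* i) := 2 :× ((b :- a) :* i)) refl
        (b · 1#) (a · 1#) (1/ b) ⟩
    2 · ((b · 1# - a · 1#) * 1/ b)
      ≤⟨ +-mono-≤ gap (+-mono-≤ gap ≤-refl) ⟩
    2 · (harmonic b - harmonic a) ∎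
    where
    open ≤-Reasoning
    a b : ℕ
    a = count A
    b = count B
    gap : (b · 1# - a · 1#) * 1/ b ≤ harmonic b - harmonic a
    gap = harmonic-gap (count-mono (λ i → P⊆B i ∘ A⊆P i)) ℕ.≤-refl
    -- The distance of `x` and `y` is their sum minus twice their minimum, and `z` is below the
    -- minimum.
    pointwise : ∀ {x y z} → z ≤ x → z ≤ y → ∣ x - y ∣ ≤ (x + y) - 2 · z
    pointwise {x} {y} {z} z≤x z≤y = ∣x∣≤
      (≤-gap (solve 3 (λ x y z → ((x :+ y) :- 2 :× z) :- (x :- y) := 2 :× (y :- z)) refl x y z)
        (double (x≤y⇒0≤y-x z≤y)))
      (≤-gap (solve 3 (λ x y z → ((x :+ y) :- 2 :× z) :- (:- (x :- y)) := 2 :× (x :- z)) refl x y z)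
        (double (x≤y⇒0≤y-x z≤x)))
      where
      double : ∀ {t} → 0# ≤ t → 0# ≤ 2 · t
      double 0≤t = +-nonneg 0≤t (+-nonneg 0≤t ≤-refl)

  -- Each of the `n` additional terms is at most `1/ (suc m)`.
  harmonic-+ : ∀ m n → harmonic (suc m ℕ.+ n) ≤ harmonic (suc m) + n · 1/ (suc m)
  harmonic-+ m zero    = ≤-reflexive (trans (reflexive (≡.cong harmonic (ℕ.+-identityʳ (suc m))))
    (sym (+-identityʳ _)))
  harmonic-+ m (suc n) = ≤-trans (≤-reflexive (reflexive (≡.cong harmonic (ℕ.+-suc (suc m) n))))
    (≤-trans (+-mono-≤ (harmonic-+ m n) (1/-antitone {m} {suc (suc m ℕ.+ n)}
      (ℕ.s≤s (ℕ.m≤n⇒m≤1+n (ℕ.m≤m+n m n)))))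
      (≤-reflexive (solve 3 (λ h t i → (h :+ t) :+ i := h :+ (i :+ t)) refl (harmonic (suc m))
        (n · 1/ (suc m)) (1/ (suc m)))))

  harmonic-double : ∀ m → harmonic (m ℕ.+ m) ≤ harmonic m + 1#
  harmonic-double zero    = ≤-trans 0≤1 (≤-reflexive (sym (+-identityˡ _)))
  harmonic-double (suc m) = ≤-trans (harmonic-+ m (suc m))
    (+-mono-≤ ≤-refl (≤-reflexive (trans (n·x≈n·1*x (suc m) _) (n*1/n m))))

  -- Passing from `⌈ n /2⌉` to `n` adds at most 1 to the harmonic number and exactly 1 to the
  -- rounded logarithm, once `n` is at least 2.
  harmonic≤1+log : ∀ n → harmonic n ≤ (1 ℕ.+ ⌈log₂ n ⌉) · 1#
  harmonic≤1+log n = go (<-wellFounded n)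
    where
    go : ∀ {n} → Acc ℕ._<_ n → harmonic n ≤ (1 ℕ.+ ⌈log₂ n ⌉) · 1#
    go {0} _ = 0≤n·1 (1 ℕ.+ ⌈log₂ 0 ⌉)
    go {1} _ = ≤-trans (≤-reflexive (trans (+-identityˡ _)
      (trans (sym (*-identityˡ _)) (trans (*-congʳ (sym (+-identityʳ 1#)))
        (trans (n*1/n 0) (sym (+-identityʳ 1#)))))))
                 (n·1-mono-≤ {1} {1 ℕ.+ ⌈log₂ 1 ⌉} (ℕ.s≤s ℕ.z≤n))
    go {suc (suc n)} (acc rec) = begin
      harmonic N                       ≤⟨ harmonic-mono N≤h+h ⟩
      harmonic (h ℕ.+ h)               ≤⟨ harmonic-double h ⟩
      harmonic h + 1#                  ≤⟨ +-mono-≤ (go (rec (ℕ.⌈n/2⌉<n n))) ≤-refl ⟩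
      (1 ℕ.+ ⌈log₂ h ⌉) · 1# + 1#       ≈⟨ +-comm _ 1# ⟩
      (2 ℕ.+ ⌈log₂ h ⌉) · 1#            ≈⟨ reflexive (≡.cong (λ l → (1 ℕ.+ l) · 1#) log-h) ⟩
      (1 ℕ.+ ⌈log₂ N ⌉) · 1#            ∎
      where
      open ≤-Reasoning
      N h : ℕ
      N = suc (suc n)
      h = ⌈ N /2⌉
      N≤h+h : N ℕ.≤ h ℕ.+ h
      N≤h+h = ≡.subst (ℕ._≤ h ℕ.+ h) (ℕ.⌊n/2⌋+⌈n/2⌉≡n N) (ℕ.+-monoˡ-≤ h (ℕ.⌊n/2⌋≤⌈n/2⌉ N))
      log-h : suc ⌈log₂ h ⌉ ≡ ⌈log₂ N ⌉
      log-h = ≡.trans (≡.cong suc (⌈log₂⌈n/2⌉⌉≡⌈log₂n⌉∸1 N))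
        (ℕ.m+[n∸m]≡n {1} (⌈log₂⌉-mono-≤ {2} {N} (ℕ.s≤s (ℕ.s≤s ℕ.z≤n))))

-- Blackwell approachability.

module Approachability (R : Reals) where
  open RealArithmetic R
  open ≤-Reasoning

  square-mono-≤ : ∀ {x y} → 0# ≤ x → x ≤ y → x * x ≤ y * y
  square-mono-≤ 0≤x x≤y = ≤-trans (*-monoˡ-≤ 0≤x x≤y) (*-monoʳ-≤ (≤-trans 0≤x x≤y) x≤y)

  -- The positive part of `b + s` is at most the absolute value of `(s ∨ 0#) + b`, whose square is
  -- the right-hand side.
  positive-part-step : ∀ b s → ((b + s) ∨ 0#) * ((b + s) ∨ 0#) ≤
    (s ∨ 0#) * (s ∨ 0#) + 2 · ((s ∨ 0#) * b) + b * b
  positive-part-step b s = ≤-trans (≤-by-cases 0# (b + s)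
      (λ 0≤b+s → square-mono-≤ (y≤∨ _ _) (≤-trans (∨-least ≤-refl 0≤b+s)
        (≤-trans (+-mono-≤ ≤-refl (x≤∨ s 0#)) (≤-reflexive (+-comm b _)))))
      (λ b+s≤0 → ≤-trans (square-mono-≤ (y≤∨ _ _) (∨-least b+s≤0 ≤-refl))
        (≤-trans (≤-reflexive (zeroˡ 0#)) (square-nonneg _))))
    (≤-reflexive (solve 2 (λ p b → (p :+ b) :* (p :+ b) := p :* p :+ 2 :× (p :* b) :+ b :* b) refl
      (s ∨ 0#) b))

  -- `f x h` is the payoff of `x` in coordinate `h`. The bound `κ` on the weighted payoff does not
  -- grow with the weights `z`, so one round adds at most `2 · κ + m · B` to the sum of squared
  -- positive parts.
  module _ {X : Set} {m : ℕ} (f : X → Fin m → Carrier) (κ B : Carrier)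
    (respond : (z : Fin m → Carrier) → (∀ h → 0# ≤ z h) → Σ X λ x →
      sum (λ h → z h * f x h) ≤ κ × (∀ h → f x h * f x h ≤ B)) where

    private
      K : Carrier
      K = 2 · κ + m · B

    -- Blackwell approachability of the negative orthant: always respond to the
    -- positive part of the accumulated payoff.
    approach : ∀ T → Σ (Fin T → X) λ xs → sum (λ h →
        (sum (λ τ → f (xs τ) h) ∨ 0#) * (sum (λ τ → f (xs τ) h) ∨ 0#))
      ≤ T · K
    approach zero = (λ ()) , ≤-trans (sum-mono-≤ {m} {g = λ _ → 0#} λ h →
        ≤-trans (square-mono-≤ (y≤∨ _ _) (∨-least ≤-refl ≤-refl)) (≤-reflexive (zeroˡ 0#)))
      (≤-reflexive (sum-replicate-zero m))
    approach (suc T) with approach T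
    ... | xs , bound with respond (λ h → sum (λ τ → f (xs τ) h) ∨ 0#) (λ h → y≤∨ _ _)
    ... | x , weighted , small = x ∷ xs , (begin
      sum (λ h → ((f x h + S h) ∨ 0#) * ((f x h + S h) ∨ 0#))
        ≤⟨ sum-mono-≤ (λ h → positive-part-step (f x h) (S h)) ⟩
      sum (λ h → P h * P h + 2 · (P h * f x h) + f x h * f x h)
        ≈⟨ trans (∑-distrib-+ (λ h → P h * P h + 2 · (P h * f x h)) (λ h → f x h * f x h))
             (+-congʳ (trans (∑-distrib-+ (λ h → P h * P h) (λ h → 2 · (P h * f x h)))
               (+-congˡ (trans (∑-distrib-+ (λ h → P h * f x h) (λ h → P h * f x h + 0#))
                  (+-congˡ (trans (∑-distrib-+ (λ h → P h * f x h) (λ h → 0#))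
                    (+-congˡ (sum-replicate-zero m)))))))) ⟩
      sum (λ h → P h * P h) + 2 · sum (λ h → P h * f x h) + sum (λ h → f x h * f x h)
        ≤⟨ +-mono-≤ (+-mono-≤ bound (+-mono-≤ weighted (+-mono-≤ weighted ≤-refl)))
             (≤-trans (sum-mono-≤ small) (≤-reflexive (sum-const m B))) ⟩
      T · (2 · κ + m · B) + 2 · κ + m · B
        ≈⟨ solve 3 (λ t k b → t :+ k :+ b := (k :+ b) :+ t) refl (T · (2 · κ + m · B)) (2 · κ) (m · B) ⟩
      suc T · (2 · κ + m · B) ∎)
      where
      S P : Fin m → Carrier
      S h = sum (λ τ → f (xs τ) h)
      P h = S h ∨ 0#

    private
      -- The squares grow only linearly with the number of rounds: each squared positive part is at
      -- most `suc T · K`, which is below the square of `suc T · 1#` once `T` exceeds `K`.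
      small-average : ∀ {T} → K < T · 1# → (S : Fin m → Carrier) →
        sum (λ h → (S h ∨ 0#) * (S h ∨ 0#)) ≤ suc T · K → ∀ h → S h ≤ suc T · 1#
      small-average {T} K<T S bound h = square-cancel-≤ (0≤n·1 (suc T))
        (≤-trans (term≤sum {f = λ h → (S h ∨ 0#) * (S h ∨ 0#)} (λ h → square-nonneg (S h ∨ 0#)) h)
          (≤-trans bound square))
        where
        square : suc T · K ≤ suc T · 1# * suc T · 1#
        square = ≤-trans (≤-reflexive (n·x≈n·1*x (suc T) K))
          (*-monoˡ-≤ (0≤n·1 (suc T)) (≤-trans (<⇒≤ K<T)
            (≤-gap (solve 2 (λ o t → (o :+ t) :- t := o) refl 1# (T · 1#)) 0≤1)))

    approach-average : ∃[ T ] Σ (Fin (suc T) → X) λ xs → ∀ h → sum (λ τ → f (xs τ) h) ≤ suc T · 1#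
    approach-average with archimedean K
    ... | T , K<T = T , proj₁ (approach (suc T)) ,
      small-average {T} K<T (λ h → sum (λ τ → f (proj₁ (approach (suc T)) τ) h)) (proj₂ (approach (suc T)))

-- From embeddings for all edge lengths to one matrix of low congestion.

module Minimax {R : Reals} (G : Network R) {k : ℕ} (K : Fin k ↣ Fin (Network.∣V∣ G)) where
  open RealArithmetic R
  open Network G
  open Certificates G
  open Injection K using (to)
  open Approachability R

  Lipschitz : Carrier → (Fin ∣E∣ → ℕ) → (Fin ∣V∣ → Fin ∣E∣ → Carrier) → Set
  Lipschitz a y M = ∀ e → sum (λ h → y h · 1# * stretch M e h) ≤ a * y e · 1#

  1≤n·1⇒1≤n : ∀ n → 1# ≤ n · 1# → 1 ℕ.≤ n
  1≤n·1⇒1≤n zero    1≤0 = ⊥-elim (1≤0 0<1)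
  1≤n·1⇒1≤n (suc n) _   = ℕ.s≤s ℕ.z≤n

  ∂-linear : ∀ {T} c (x : Fin T → Fin ∣E∣ → Carrier) v →
    ∂ (λ e → c * sum (λ τ → x τ e)) v ≈ c * sum (λ τ → ∂ (x τ) v)
  ∂-linear c x v = begin
    sum (λ e → w e * (c * sum (λ τ → x τ e)))
      ≈⟨ sum-cong-≋ (λ e → trans (solve 3 (λ w c s → w :* (c :* s) := c :* (w :* s)) refl (w e) c
        (sum (λ τ → x τ e)))
           (*-congˡ (*-distribˡ-sum (w e) (λ τ → x τ e)))) ⟩
    sum (λ e → c * sum (λ τ → w e * x τ e))
      ≈⟨ *-distribˡ-sum c (λ e → sum (λ τ → w e * x τ e)) ⟨
    c * sum (λ e → sum (λ τ → w e * x τ e))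
      ≈⟨ *-congˡ (∑-comm (λ e τ → w e * x τ e)) ⟩
    c * sum (λ τ → ∂ (x τ) v) ∎
    where
    open Relation.Binary.Reasoning.Setoid setoid
    w : Fin ∣E∣ → Carrier
    w e = δ (src e) v - δ (dst e) v

  module _ (a : Carrier) (0≤a : 0# ≤ a)
    (embed : (y : Fin ∣E∣ → ℕ) → (∀ e → 1 ℕ.≤ y e) → ∃[ M ] RoutesTerminals K M × Lipschitz a y M) where

    X : Set
    X = Σ (Fin ∣V∣ → Fin ∣E∣ → Carrier) (RoutesTerminals K)

    -- The congestion of `h` when every edge is filled to capacity and rerouted by `M`.
    q : X → Fin ∣E∣ → Carrier
    q (M , _) h = divide (sum (λ e → stretch M e h * cap e)) (cap h) (cap-pos h)

    m : Carrier
    m = ∣E∣ · 1#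

    -- The edge `e₀` makes the number of edges `m` and the total capacity `Λ` positive, so that both
    -- can be cancelled.
    module _ (e₀ : Fin ∣E∣) where
      1≤m : 1# ≤ m
      1≤m = ≤-trans (term≤sum {f = λ _ → 1#} (λ _ → 0≤1) e₀) (≤-reflexive (sum-const ∣E∣ 1#))

      0<m : 0# < m
      0<m = <-≤-trans 0<1 1≤m

      Λ : Carrier
      Λ = sum cap

      0<Λ : 0# < Λ
      0<Λ = <-≤-trans (cap-pos e₀) (term≤sum (λ e → <⇒≤ (cap-pos e)) e₀)

      0≤Λ : 0# ≤ Λ
      0≤Λ = sum-nonneg (λ e → <⇒≤ (cap-pos e))

      0≤q : ∀ x h → 0# ≤ q x h
      0≤q (M , _) h = divide-nonneg (sum-nonneg λ e → *-nonneg (0≤∣x∣ _) (<⇒≤ (cap-pos e))) (cap-pos h)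

      module Response (z : Fin ∣E∣ → Carrier) (0≤z : ∀ h → 0# ≤ z h) where
        open ≤-Reasoning

        Z : Carrier
        Z = sum z

        -- The share Z + 1 keeps every length comparable to the total, which
        -- bounds the congestion of a response independently of z.
        u w : Fin ∣E∣ → Carrier
        u h = m * z h + (Z + 1#)
        w h = divide (Λ * u h) (cap h) (cap-pos h)

        0≤Z : 0# ≤ Z
        0≤Z = sum-nonneg 0≤z

        1≤u : ∀ h → 1# ≤ u h
        1≤u h = ≤-gap (solve 3 (λ a b o → (a :+ (b :+ o)) :- o := a :+ b) refl (m * z h) Z 1#)
          (+-nonneg (*-nonneg (<⇒≤ 0<m) (0≤z h)) 0≤Z)

        -- The factor `Λ` in `w` serves this bound, as `cap h` is at most the total capacity.
        -- Lengths of at least 1 can be rounded up to integers with a loss of at most a factor 3.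
        1≤w : ∀ h → 1# ≤ w h
        1≤w h = *-cancelʳ-≤ (cap-pos h) (begin
          1# * cap h     ≈⟨ *-identityˡ _ ⟩
          cap h          ≤⟨ term≤sum (λ e → <⇒≤ (cap-pos e)) h ⟩
          Λ              ≈⟨ *-identityʳ Λ ⟨
          Λ * 1#         ≤⟨ *-monoˡ-≤ 0≤Λ (1≤u h) ⟩
          Λ * u h        ≈⟨ divide*≈ _ (cap-pos h) ⟨
          w h * cap h    ∎)

        0≤w : ∀ h → 0# ≤ w h
        0≤w h = ≤-trans 0≤1 (1≤w h)

        y : Fin ∣E∣ → ℕ
        y h = proj₁ (natural-above (w h) (0≤w h))

        w≤y : ∀ h → w h ≤ y h · 1#
        w≤y h = proj₁ (proj₂ (natural-above (w h) (0≤w h)))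

        y≤3w : ∀ h → y h · 1# ≤ 3 · w h
        y≤3w h = ≤-trans (proj₂ (proj₂ (natural-above (w h) (0≤w h))))
          (≤-gap (solve 1 (λ w → 3 :× w :- (w :+ 2 :× :1) := (w :- :1) :+ (w :- :1)) refl (w h))
            (+-nonneg (x≤y⇒0≤y-x (1≤w h)) (x≤y⇒0≤y-x (1≤w h))))

        1≤y : ∀ h → 1 ℕ.≤ y h
        1≤y h = 1≤n·1⇒1≤n (y h) (≤-trans (1≤w h) (w≤y h))

        M : Fin ∣V∣ → Fin ∣E∣ → Carrier
        M = proj₁ (embed y 1≤y)

        x : X
        x = M , proj₁ (proj₂ (embed y 1≤y))

        -- The Lipschitz bound for `e`, multiplied by `cap e`. The capacity cancels against the one
        -- in the denominator of `w e`.
        per-edge : ∀ e → sum (λ h → w h * (stretch M e h * cap e)) ≤ Λ * (3 · a * u e)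
        per-edge e = begin
          sum (λ h → w h * (stretch M e h * cap e))
            ≤⟨ sum-mono-≤ (λ h → *-monoʳ-≤ (*-nonneg (0≤∣x∣ _) (<⇒≤ (cap-pos e))) (w≤y h)) ⟩
          sum (λ h → y h · 1# * (stretch M e h * cap e))
            ≈⟨ sum-cong-≋ (λ h → *-assoc (y h · 1#) (stretch M e h) (cap e)) ⟨
          sum (λ h → y h · 1# * stretch M e h * cap e)
            ≈⟨ *-distribʳ-sum (cap e) (λ h → y h · 1# * stretch M e h) ⟨
          sum (λ h → y h · 1# * stretch M e h) * cap e
            ≤⟨ *-monoʳ-≤ (<⇒≤ (cap-pos e)) (≤-trans (proj₂ (proj₂ (embed y 1≤y)) e)
              (*-monoˡ-≤ 0≤a (y≤3w e))) ⟩
          a * 3 · w e * cap e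
            ≈⟨ solve 3 (λ a w c → a :* (3 :× w) :* c := 3 :× a :* (w :* c)) refl a (w e) (cap e) ⟩
          3 · a * (w e * cap e)
            ≈⟨ *-congˡ (divide*≈ _ (cap-pos e)) ⟩
          3 · a * (Λ * u e)
            ≈⟨ solve 3 (λ a l u → a :* (l :* u) := l :* (a :* u)) refl (3 · a) Λ (u e) ⟩
          Λ * (3 · a * u e) ∎

        w*load : ∀ h → w h * sum (λ e → stretch M e h * cap e) ≈ Λ * (u h * q x h)
        w*load h = trans (*-congˡ (sym (divide*≈ _ (cap-pos h))))
          (trans (solve 3 (λ w q c → w :* (q :* c) := (w :* c) :* q) refl (w h) (q x h) (cap h))
            (trans (*-congʳ (divide*≈ _ (cap-pos h))) (*-assoc Λ (u h) (q x h))))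

        -- Exchanging the sums over the rerouted edges `e` and the loaded edges `h` makes `per-edge`
        -- applicable; the factor `m * (2 · Z + 1#)` is the sum of `u`.
        total : sum (λ h → u h * q x h) ≤ 3 · a * (m * (2 · Z + 1#))
        total = *-cancelʳ-≤ 0<Λ (begin
          sum (λ h → u h * q x h) * Λ
            ≈⟨ trans (*-comm _ Λ) (*-distribˡ-sum Λ (λ h → u h * q x h)) ⟩
          sum (λ h → Λ * (u h * q x h))
            ≈⟨ sum-cong-≋ (λ h → trans (sym (w*load h)) (*-distribˡ-sum (w h)
              (λ e → stretch M e h * cap e))) ⟩
          sum (λ h → sum λ e → w h * (stretch M e h * cap e))
            ≈⟨ ∑-comm (λ h e → w h * (stretch M e h * cap e)) ⟩
          sum (λ e → sum λ h → w h * (stretch M e h * cap e))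
            ≤⟨ sum-mono-≤ per-edge ⟩
          sum (λ e → Λ * (3 · a * u e))
            ≈⟨ trans (*-congˡ (*-distribˡ-sum (3 · a) u)) (*-distribˡ-sum Λ (λ e → 3 · a * u e)) ⟨
          Λ * (3 · a * sum u)
            ≈⟨ *-congˡ (*-congˡ (trans (∑-distrib-+ (λ h → m * z h) (λ _ → Z + 1#))
                 (+-cong (sym (*-distribˡ-sum m z)) (trans (sum-const ∣E∣ _) (n·x≈n·1*x ∣E∣ _))))) ⟩
          Λ * (3 · a * (m * Z + m * (Z + 1#)))
            ≈⟨ solve 4 (λ l a m z → l :* (a :* (m :* z :+ m :* (z :+ :1))) := a :* (m :* (2 :× z :+ :1)) :* l)
                 refl Λ (3 · a) m Z ⟩
          3 · a * (m * (2 · Z + 1#)) * Λ ∎)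

        -- The share `m * z h` of `u h` alone already satisfies the bound on the total.
        weighted : sum (λ h → z h * q x h) ≤ 3 · a * (2 · Z + 1#)
        weighted = *-cancelʳ-≤ 0<m (begin
          sum (λ h → z h * q x h) * m
            ≈⟨ trans (*-comm _ m) (*-distribˡ-sum m (λ h → z h * q x h)) ⟩
          sum (λ h → m * (z h * q x h))
            ≤⟨ sum-mono-≤ (λ h → ≤-gap (solve 4 (λ m z s q → (m :* z :+ s) :* q :- m :* (z :* q) := s :* q)
                 refl m (z h) (Z + 1#) (q x h)) (*-nonneg (+-nonneg 0≤Z 0≤1) (0≤q x h))) ⟩
          sum (λ h → u h * q x h)
            ≤⟨ total ⟩
          3 · a * (m * (2 · Z + 1#))
            ≈⟨ solve 3 (λ a m s → a :* (m :* s) := a :* s :* m) refl (3 · a) m (2 · Z + 1#) ⟩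
          3 · a * (2 · Z + 1#) * m ∎)

        -- Here the share `Z + 1#` of `u h` is used; the dependence on `z` disappears because
        -- `2 · Z + 1#` is at most twice `Z + 1#`.
        bounded : ∀ h → q x h ≤ 6 · a * m
        bounded h = *-cancelʳ-≤ (<-≤-trans 0<1 1≤Z+1) (begin
          q x h * (Z + 1#)
            ≤⟨ ≤-gap (solve 3 (λ v s q → (v :+ s) :* q :- q :* s := v :* q) refl (m * z h) (Z + 1#) (q x h))
                 (*-nonneg (*-nonneg (<⇒≤ 0<m) (0≤z h)) (0≤q x h)) ⟩
          u h * q x h
            ≤⟨ term≤sum (λ h → *-nonneg (≤-trans 0≤1 (1≤u h)) (0≤q x h)) h ⟩
          sum (λ h → u h * q x h)
            ≤⟨ total ⟩
          3 · a * (m * (2 · Z + 1#))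
            ≤⟨ ≤-gap (solve 3 (λ a m z → 6 :× a :* m :* (z :+ :1) :- 3 :× a :*
              (m :* (2 :× z :+ :1)) := 3 :× (a :* m))
                 refl a m Z) (triple (*-nonneg 0≤a (<⇒≤ 0<m))) ⟩
          6 · a * m * (Z + 1#) ∎)
          where
          1≤Z+1 : 1# ≤ Z + 1#
          1≤Z+1 = ≤-gap (solve 2 (λ z o → (z :+ o) :- o := z) refl Z 1#) 0≤Z
          triple : ∀ {t} → 0# ≤ t → 0# ≤ 3 · t
          triple 0≤t = +-nonneg 0≤t (+-nonneg 0≤t (+-nonneg 0≤t ≤-refl))

      -- The payoff is the excess of the congestion over `6 · a`. Subtracting `Z * 6 · a` from
      -- `3 · a * (2 · Z + 1#)` removes `Z` and leaves the constant `3 · a`.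
      respond : ∀ z → (∀ h → 0# ≤ z h) →
        ∃[ x ] (sum (λ h → z h * (q x h - 6 · a)) ≤ 3 · a) ×
               (∀ h → (q x h - 6 · a) * (q x h - 6 · a) ≤ 6 · a * m * (6 · a * m))
      respond z 0≤z = x , (begin
          sum (λ h → z h * (q x h - 6 · a))
            ≈⟨ sum-cong-≋ (λ h → solve 3 (λ z q b → z :* (q :- b) := z :* q :- z :* b) refl (z h) (q x h)
              (6 · a)) ⟩
          sum (λ h → z h * q x h - z h * 6 · a)
            ≈⟨ trans (sum-distrib-- (λ h → z h * q x h) (λ h → z h * 6 · a))
                 (+-congˡ (-‿cong (sym (*-distribʳ-sum (6 · a) z)))) ⟩
          sum (λ h → z h * q x h) - Z * 6 · a
            ≤⟨ +-mono-≤ weighted ≤-refl ⟩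
          3 · a * (2 · Z + 1#) - Z * 6 · a
            ≈⟨ solve 2 (λ a z → 3 :× a :* (2 :× z :+ :1) :- z :* (6 :× a) := 3 :× a) refl a Z ⟩
          3 · a ∎)
        -- Both `q x h` and `6 · a` lie between 0 and `6 · a * m`, the latter by `1≤m`, so their
        -- difference has absolute value at most `6 · a * m`.
        , λ h → ≤-gap (solve 2 (λ b f → b :* b :- f :* f := (b :- f) :* (b :+ f)) refl (6 · a * m)
          (q x h - 6 · a))
            (*-nonneg
              (≤-trans (+-nonneg (x≤y⇒0≤y-x (bounded h)) 0≤6a)
                (≤-reflexive (solve 3 (λ b q s → (b :- q) :+ s := b :- (q :- s)) refl (6 · a * m) (q x h)
                  (6 · a))))
              (≤-trans (+-nonneg (*-nonneg 0≤6a (x≤y⇒0≤y-x 1≤m)) (0≤q x h))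
                (≤-reflexive (solve 3 (λ s m q → s :* (m :- :1) :+ q := s :* m :+ (q :- s)) refl (6 · a) m
                  (q x h)))))
        where
        open Response z 0≤z
        open ≤-Reasoning
        0≤6a : 0# ≤ 6 · a
        0≤6a = ≤-trans (*-nonneg (0≤n·1 6) 0≤a) (≤-reflexive (sym (n·x≈n·1*x 6 a)))

      Balanced : Set
      Balanced = ∃[ M ] RoutesTerminals K M × (∀ h → sum (λ e → stretch M e h * cap e) ≤ (6 · a + 1#) * cap h)

      -- The boundary is linear and `stretch` is convex in the matrix, so routing and congestion
      -- bounds pass to the mean. A mean excess of at most 1 gives the factor `6 · a + 1#`.
      average : ∀ {T} (xs : Fin (suc T) → X) →
        (∀ h → sum (λ τ → q (xs τ) h - 6 · a) ≤ suc T · 1#) → Balanced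
      average {T} xs bound = M , routes , congested
        where
        t⁻¹ : Carrier
        t⁻¹ = 1/ (suc T)

        M : Fin ∣V∣ → Fin ∣E∣ → Carrier
        M v h = t⁻¹ * sum (λ τ → proj₁ (xs τ) v h)

        difference : ∀ u v h →
          M u h - M v h ≈ t⁻¹ * sum (λ τ → proj₁ (xs τ) u h - proj₁ (xs τ) v h)
        difference u v h = trans
          (solve 3 (λ c a b → c :* a :- c :* b := c :* (a :- b)) refl
            t⁻¹ (sum λ τ → proj₁ (xs τ) u h) (sum λ τ → proj₁ (xs τ) v h))
          (*-congˡ (sym (sum-distrib-- (λ τ → proj₁ (xs τ) u h) (λ τ → proj₁ (xs τ) v h))))

        routes : RoutesTerminals K M
        routes s t conn v = trans (∂-cong (difference (to s) (to t)) v)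
          (trans (∂-linear t⁻¹ (λ τ e → proj₁ (xs τ) (to s) e - proj₁ (xs τ) (to t) e) v)
            (trans (*-congˡ (trans (sum-cong-≋ (λ τ → proj₂ (xs τ) s t conn v))
                (trans (sum-const (suc T) _) (n·x≈n·1*x (suc T) _))))
              (trans (sym (*-assoc t⁻¹ _ _)) (trans (*-congʳ (divide*≈ 1# (0<n·1 T))) (*-identityˡ _)))))

        average-q : ∀ h → sum (λ τ → q (xs τ) h) ≤ suc T · 1# * (6 · a + 1#)
        average-q h = begin
          sum (λ τ → q (xs τ) h)
            ≈⟨ solve 2 (λ s b → s := (s :- b) :+ b) refl (sum (λ τ → q (xs τ) h)) (suc T · 1# * 6 · a) ⟩
          (sum (λ τ → q (xs τ) h) - suc T · 1# * 6 · a) + suc T · 1# * 6 · a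
            ≈⟨ +-congʳ (trans (sum-distrib-- (λ τ → q (xs τ) h) (λ _ → 6 · a))
                 (+-congˡ (-‿cong (trans (sum-const (suc T) (6 · a)) (n·x≈n·1*x (suc T) (6 · a)))))) ⟨
          sum (λ τ → q (xs τ) h - 6 · a) + suc T · 1# * 6 · a
            ≤⟨ +-mono-≤ (bound h) ≤-refl ⟩
          suc T · 1# + suc T · 1# * 6 · a
            ≈⟨ solve 2 (λ t b → t :+ t :* b := t :* (b :+ :1)) refl (suc T · 1#) (6 · a) ⟩
          suc T · 1# * (6 · a + 1#) ∎
          where open ≤-Reasoning

        congested : ∀ h → sum (λ e → stretch M e h * cap e) ≤ (6 · a + 1#) * cap h
        congested h = begin
          sum (λ e → stretch M e h * cap e)
            ≤⟨ sum-mono-≤ (λ e → *-monoʳ-≤ (<⇒≤ (cap-pos e)) (begin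
                 ∣ M (src e) h - M (dst e) h ∣                ≤⟨ ∣∣-monoˡ (difference (src e) (dst e) h) ⟩
                 ∣ t⁻¹ * sum (Δ e) ∣                          ≤⟨ ∣x*y∣≤x*∣y∣ (0≤1/ (suc T)) _ ⟩
                 t⁻¹ * ∣ sum (Δ e) ∣                          ≤⟨ *-monoˡ-≤ (0≤1/ (suc T))
                   (∣sum∣≤sum∣∣ (Δ e)) ⟩
                 t⁻¹ * sum (λ τ → stretch (proj₁ (xs τ)) e h) ∎)) ⟩
          sum (λ e → t⁻¹ * sum (λ τ → stretch (proj₁ (xs τ)) e h) * cap e)
            ≈⟨ sum-cong-≋ (λ e → trans (*-assoc t⁻¹ _ (cap e))
              (*-congˡ (*-distribʳ-sum (cap e) (λ τ → stretch (proj₁ (xs τ)) e h)))) ⟩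
          sum (λ e → t⁻¹ * sum (λ τ → stretch (proj₁ (xs τ)) e h * cap e))
            ≈⟨ trans (*-congˡ (∑-comm (λ τ e → stretch (proj₁ (xs τ)) e h * cap e)))
                 (*-distribˡ-sum t⁻¹ (λ e → sum (λ τ → stretch (proj₁ (xs τ)) e h * cap e))) ⟨
          t⁻¹ * sum (λ τ → sum (λ e → stretch (proj₁ (xs τ)) e h * cap e))
            ≈⟨ *-congˡ (trans (*-distribʳ-sum (cap h) (λ τ → q (xs τ) h))
                 (sum-cong-≋ {suc T} (λ τ → divide*≈ (sum (λ e → stretch (proj₁ (xs τ)) e h * cap e))
                   (cap-pos h)))) ⟨
          t⁻¹ * (sum (λ τ → q (xs τ) h) * cap h)
            ≤⟨ *-monoˡ-≤ (0≤1/ (suc T)) (*-monoʳ-≤ (<⇒≤ (cap-pos h)) (average-q h)) ⟩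
          t⁻¹ * (suc T · 1# * (6 · a + 1#) * cap h)
            ≈⟨ solve 4 (λ i t b c → i :* (t :* b :* c) := (i :* t) :* (b :* c)) refl t⁻¹ (suc T · 1#)
              (6 · a + 1#) (cap h) ⟩
          t⁻¹ * suc T · 1# * ((6 · a + 1#) * cap h)
            ≈⟨ trans (*-congʳ (divide*≈ 1# (0<n·1 T))) (*-identityˡ _) ⟩
          (6 · a + 1#) * cap h ∎
          where
          open ≤-Reasoning
          Δ : Fin ∣E∣ → Fin (suc T) → Carrier
          Δ e τ = proj₁ (xs τ) (src e) h - proj₁ (xs τ) (dst e) h

      balanced : Balanced
      balanced = average (proj₁ (proj₂ strategy)) (proj₂ (proj₂ strategy))
        where
        strategy : ∃[ T ] Σ (Fin (suc T) → X) λ xs → ∀ h → sum (λ τ → q (xs τ) h - 6 · a) ≤ suc T · 1#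
        strategy = approach-average (λ x h → q x h - 6 · a) (3 · a) (6 · a * m * (6 · a * m)) respond

    inhabited? : ∀ n → Fin n ⊎ (Fin n → ⊥)
    inhabited? zero    = inj₂ λ ()
    inhabited? (suc n) = inj₁ zero

    minimax : ∃[ M ] RoutesTerminals K M ×
      (∀ h → sum (λ e → stretch M e h * cap e) ≤ (6 · a + 1#) * cap h)
    minimax with inhabited? ∣E∣
    ... | inj₁ e₀    = balanced e₀
    -- Without edges the congestion bound is vacuous, and any lengths give a matrix that routes the
    -- terminals.
    ... | inj₂ empty with embed (λ _ → 1) (λ _ → ℕ.s≤s ℕ.z≤n)
    ...   | M , routes , _ = M , routes , λ h → ⊥-elim (empty h)

-- Decisions as Booleans, and sums over a dyadic tree of radii.

does⇒ : ∀ {P : Set} (d : Dec P) → T (does d) → P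
does⇒ (yes p) _ = p

⇒does : ∀ {P : Set} (d : Dec P) → P → T (does d)
⇒does (yes _) _ = _
⇒does (no ¬p) p = contradiction p ¬p

module DyadicSums (R : Reals) where
  open RealArithmetic R

  range : (ℕ → Carrier) → ℕ → Carrier
  range g zero    = 0#
  range g (suc n) = range g n + g n

  range-mono-≤ : ∀ {f g} → (∀ n → f n ≤ g n) → ∀ n → range f n ≤ range g n
  range-mono-≤ f≤g zero    = ≤-refl
  range-mono-≤ f≤g (suc n) = +-mono-≤ (range-mono-≤ f≤g n) (f≤g n)

  range-telescope : ∀ (ψ : ℕ → Carrier) n → range (λ r → ψ (suc r) - ψ r) n ≈ ψ n - ψ 0
  range-telescope ψ zero    = solve 1 (λ p → :0 := p :- p) refl (ψ 0)
  range-telescope ψ (suc n) = trans (+-congʳ (range-telescope ψ n))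
    (solve 3 (λ a b c → (a :- b) :+ (c :- a) := c :- b) refl (ψ n) (ψ 0) (ψ (suc n)))

  range-distrib-+ : ∀ f g n → range (λ r → f r + g r) n ≈ range f n + range g n
  range-distrib-+ f g zero    = sym (+-identityˡ 0#)
  range-distrib-+ f g (suc n) = trans (+-congʳ (range-distrib-+ f g n))
    (solve 4 (λ a b c d → (a :+ b) :+ (c :+ d) := (a :+ c) :+ (b :+ d)) refl (range f n) (range g n) (f n)
      (g n))

  module _ (Φ : ℕ → Carrier) (η : Carrier) (0≤Φ : ∀ r → 0# ≤ Φ r) (Φ≤η : ∀ r → Φ r ≤ η) where

    range-step≤ : ∀ (s : ℕ → ℕ) n → range (λ r → Φ (s (suc r)) - Φ (s r)) n ≤ η
    range-step≤ s n = ≤-trans (≤-reflexive (range-telescope (Φ ∘ s) n))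
      (≤-gap (solve 3 (λ h a b → h :- (a :- b) := (h :- a) :+ b) refl η (Φ (s n)) (Φ (s 0)))
        (+-nonneg (x≤y⇒0≤y-x (Φ≤η (s n))) (0≤Φ (s 0))))

    -- Induction on `D`: widening the window by one at both ends adds two telescoping sums, each at
    -- most `η` because `Φ` takes values between 0 and `η`.
    range-window : ∀ D n → range (λ r → Φ (D ℕ.+ r) - Φ (r ℕ.∸ D)) n ≤ 2 · (D · 1# * η)
    range-window zero n = ≤-trans (≤-reflexive (zeros n))
      (≤-reflexive (solve 1 (λ h → :0 := 2 :× (:0 :* h)) refl η))
      where
      zeros : ∀ n → range (λ r → Φ r - Φ r) n ≈ 0#
      zeros zero    = refl
      zeros (suc n) = trans (+-cong (zeros n) (-‿inverseʳ (Φ n))) (+-identityˡ 0#)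
    range-window (suc D) n = begin
      range (λ r → Φ (suc D ℕ.+ r) - Φ (r ℕ.∸ suc D)) n
        ≤⟨ range-mono-≤ (λ r → ≤-reflexive (trans
             (solve 4 (λ a b c d → a :- d := (b :- c) :+ ((a :- b) :+ (c :- d))) refl
               (Φ (suc D ℕ.+ r)) (Φ (D ℕ.+ r)) (Φ (r ℕ.∸ D)) (Φ (r ℕ.∸ suc D)))
             (+-congˡ (+-congʳ (+-congʳ (reflexive (≡.cong Φ (≡.sym (ℕ.+-suc D r))))))))) n ⟩
      range (λ r → (Φ (D ℕ.+ r) - Φ (r ℕ.∸ D)) + (up r + down r)) n
        ≈⟨ trans (range-distrib-+ (λ r → Φ (D ℕ.+ r) - Φ (r ℕ.∸ D)) (λ r → up r + down r) n)
             (+-congˡ (range-distrib-+ up down n)) ⟩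
      range (λ r → Φ (D ℕ.+ r) - Φ (r ℕ.∸ D)) n + (range up n + range down n)
        ≤⟨ +-mono-≤ (range-window D n) (+-mono-≤ (range-step≤ (D ℕ.+_) n) (range-step≤ (ℕ._∸ suc D) n)) ⟩
      2 · (D · 1# * η) + (η + η)
        ≈⟨ solve 2 (λ d h → 2 :× (d :* h) :+ (h :+ h) := 2 :× ((:1 :+ d) :* h)) refl (D · 1#) η ⟩
      2 · (suc D · 1# * η) ∎
      where
      open ≤-Reasoning
      up down : ℕ → Carrier
      up r   = Φ (D ℕ.+ suc r) - Φ (D ℕ.+ r)
      down r = Φ (r ℕ.∸ D) - Φ (r ℕ.∸ suc D)

  module _ (g : ℕ → Carrier) where
    -- The sum of `g` over the binary tree of depth `L` with root `r`, in which a node n has the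
    -- children 2n and 2n + 1.
    treeSum : ℕ → ℕ → Carrier
    treeSum zero    r = g r
    treeSum (suc L) r = g r + (treeSum L (r ℕ.+ r) + treeSum L (suc (r ℕ.+ r)))

    0≤treeSum : (∀ r → 0# ≤ g r) → ∀ L r → 0# ≤ treeSum L r
    0≤treeSum 0≤g zero    r = 0≤g r
    0≤treeSum 0≤g (suc L) r = +-nonneg (0≤g r) (+-nonneg (0≤treeSum 0≤g L _) (0≤treeSum 0≤g L _))

    private
      doubled : ℕ → ℕ → ℕ
      doubled zero    n = n
      doubled (suc i) n = doubled i (n ℕ.+ n)

      -- The nodes at depth `i` below `r` are the numbers from `doubled i r`, which is 2^i times
      -- `r`, up to but excluding `doubled i (suc r)`.
      level : ℕ → ℕ → Carrier
      level zero    r = g r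
      level (suc i) r = level i (r ℕ.+ r) + level i (suc (r ℕ.+ r))

      level≈range : ∀ i r → level i r ≈ range g (doubled i (suc r)) - range g (doubled i r)
      level≈range zero    r = solve 2 (λ a b → b := (a :+ b) :- a) refl (range g r) (g r)
      level≈range (suc i) r = trans
        (+-cong (level≈range i (r ℕ.+ r)) (level≈range i (suc (r ℕ.+ r))))
        (trans (solve 3 (λ a b c → (b :- a) :+ (c :- b) := c :- a) refl
            (range g (doubled i (r ℕ.+ r))) (range g (doubled i (suc (r ℕ.+ r))))
              (range g (doubled i (2 ℕ.+ (r ℕ.+ r)))))
          (+-congʳ (reflexive (≡.cong (range g ∘ doubled i) (≡.cong suc (≡.sym (ℕ.+-suc r r)))))))

      treeSum-suc : ∀ L r → treeSum (suc L) r ≈ treeSum L r + level (suc L) r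
      treeSum-suc zero    r = refl
      treeSum-suc (suc L) r = trans (+-congˡ (+-cong (treeSum-suc L (r ℕ.+ r))
        (treeSum-suc L (suc (r ℕ.+ r)))))
        (solve 5 (λ a b c d e → a :+ ((b :+ c) :+ (d :+ e)) := (a :+ (b :+ d)) :+ (c :+ e)) refl
          (g r) (treeSum L (r ℕ.+ r)) (level (suc L) (r ℕ.+ r))
          (treeSum L (suc (r ℕ.+ r))) (level (suc L) (suc (r ℕ.+ r))))

    -- Below the root 1, depth `i` is the block from 2^i to 2^(i+1) - 1. The blocks are consecutive,
    -- so every radius from 1 to 2^(L+1) - 1 occurs exactly once, and `g 0` completes the range.
    treeSum≈range : ∀ L → ∃[ n ] treeSum L 1 + g 0 ≈ range g n
    treeSum≈range L = doubled L 2 , go L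
      where
      go : ∀ L → treeSum L 1 + g 0 ≈ range g (doubled L 2)
      go zero    = solve 2 (λ a b → a :+ b := (:0 :+ b) :+ a) refl (g 1) (g 0)
      go (suc L) = trans (+-congʳ (treeSum-suc L 1))
        (trans (solve 3 (λ t l z → (t :+ l) :+ z := (t :+ z) :+ l) refl (treeSum L 1) (level (suc L) 1) (g 0))
          (trans (+-cong (go L) (level≈range (suc L) 1))
            (solve 2 (λ a b → a :+ (b :- a) := b) refl (range g (doubled L 2))
              (range g (doubled (suc L) 2)))))

-- The embedding for given edge lengths: flows along walks and their length-weighted norm.

module Embedding {R : Reals} (G : Network R) {k : ℕ} (K : Fin k ↣ Fin (Network.∣V∣ G))
  (y : Fin (Network.∣E∣ G) → ℕ) (1≤y : ∀ e → 1 ℕ.≤ y e) where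
  open RealArithmetic R
  open Network G
  open Certificates G
  open Minimax G K using (∂-linear; Lipschitz)
  open Walks G y 1≤y
  open UniformDistributions R
  open DyadicSums R
  open Injection K using (to)

  edge : Fin ∣E∣ → Fin ∣E∣ → Carrier
  edge e h = if does (e ≟ h) then 1# else 0#

  ∂-+ : ∀ x x′ v → ∂ (λ h → x h + x′ h) v ≈ ∂ x v + ∂ x′ v
  ∂-+ x x′ v = trans (sum-cong-≋ (λ h → distribˡ _ (x h) (x′ h)))
    (∑-distrib-+ (λ h → (δ (src h) v - δ (dst h) v) * x h) (λ h → (δ (src h) v - δ (dst h) v) * x′ h))

  ∂-- : ∀ x x′ v → ∂ (λ h → x h - x′ h) v ≈ ∂ x v - ∂ x′ v
  ∂-- x x′ v = trans (sum-cong-≋ (λ h → solve 3 (λ w a b → w :* (a :- b) := w :* a :- w :* b) refl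
      (δ (src h) v - δ (dst h) v) (x h) (x′ h)))
    (sum-distrib-- (λ h → (δ (src h) v - δ (dst h) v) * x h) (λ h → (δ (src h) v - δ (dst h) v) * x′ h))

  ∂-0 : ∀ v → ∂ (λ _ → 0#) v ≈ 0#
  ∂-0 v = trans (sum-cong-≋ (λ h → zeroʳ (δ (src h) v - δ (dst h) v))) (sum-replicate-zero ∣E∣)

  ∂-* : ∀ c x v → ∂ (λ h → c * x h) v ≈ c * ∂ x v
  ∂-* c x v = trans (sum-cong-≋ (λ h → solve 3 (λ w c a → w :* (c :* a) := c :* (w :* a)) refl
      (δ (src h) v - δ (dst h) v) c (x h)))
    (sym (*-distribˡ-sum c (λ h → (δ (src h) v - δ (dst h) v) * x h)))

  ∂-∑ : ∀ {n} (c : Fin n → Carrier) (x : Fin n → Fin ∣E∣ → Carrier) v →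
    ∂ (λ h → sum (λ i → c i * x i h)) v ≈ sum (λ i → c i * ∂ (x i) v)
  ∂-∑ c x v = trans (∂-cong (λ h → sym (*-identityˡ (sum (λ i → c i * x i h)))) v)
    (trans (∂-linear 1# (λ i h → c i * x i h) v)
      (trans (*-identityˡ _) (sum-cong-≋ (λ i → ∂-* (c i) (x i) v))))

  ∂-edge : ∀ e v → ∂ (edge e) v ≈ δ (src e) v - δ (dst e) v
  ∂-edge e v = trans (sum-cong-≋ (λ h → *-comm (δ (src h) v - δ (dst h) v) (edge e h)))
    (sum-δ e (λ h → δ (src h) v - δ (dst h) v))

  walkFlow : ∀ {u v} → Walk u v → Fin ∣E∣ → Carrier
  walkFlow []          h = 0#
  walkFlow (forth e p) h = edge e h + walkFlow p h
  walkFlow (back e p)  h = walkFlow p h - edge e h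

  ∂-walkFlow : ∀ {u v} (p : Walk u v) x → ∂ (walkFlow p) x ≈ δ u x - δ v x
  ∂-walkFlow {u} [] x = trans (∂-0 x) (sym (-‿inverseʳ (δ u x)))
  ∂-walkFlow (forth e {v} p) x = trans (∂-+ (edge e) (walkFlow p) x)
    (trans (+-cong (∂-edge e x) (∂-walkFlow p x))
      (solve 3 (λ a b c → (a :- b) :+ (b :- c) := a :- c) refl (δ (src e) x) (δ (dst e) x) (δ v x)))
  ∂-walkFlow (back e {v} p) x = trans (∂-- (walkFlow p) (edge e) x)
    (trans (+-cong (∂-walkFlow p x) (-‿cong (∂-edge e x)))
      (solve 3 (λ a b c → (a :- c) :- (a :- b) := b :- c) refl (δ (src e) x) (δ (dst e) x) (δ v x)))

  ‖_‖ : (Fin ∣E∣ → Carrier) → Carrier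
  ‖ x ‖ = sum (λ h → y h · 1# * ∣ x h ∣)

  ‖‖-mono : ∀ {x x′} → (∀ h → x h ≈ x′ h) → ‖ x ‖ ≤ ‖ x′ ‖
  ‖‖-mono x≈x′ = sum-mono-≤ λ h → *-monoˡ-≤ (0≤n·1 (y h)) (∣∣-monoˡ (x≈x′ h))

  ‖0‖≤0 : ‖ (λ _ → 0#) ‖ ≤ 0#
  ‖0‖≤0 = ≤-trans (sum-mono-≤ (λ h → ≤-trans (*-monoˡ-≤ (0≤n·1 (y h)) ∣0∣≤0) (≤-reflexive (zeroʳ _))))
    (≤-reflexive (sum-replicate-zero ∣E∣))

  ‖x+x′‖≤ : ∀ x x′ → ‖ (λ h → x h + x′ h) ‖ ≤ ‖ x ‖ + ‖ x′ ‖
  ‖x+x′‖≤ x x′ = ≤-trans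
    (sum-mono-≤ (λ h → ≤-trans (*-monoˡ-≤ (0≤n·1 (y h)) (∣x+y∣≤∣x∣+∣y∣ (x h) (x′ h)))
      (≤-reflexive (distribˡ _ _ _))))
    (≤-reflexive (∑-distrib-+ (λ h → y h · 1# * ∣ x h ∣) (λ h → y h · 1# * ∣ x′ h ∣)))

  ‖c*x‖≤ : ∀ c x → ‖ (λ h → c * x h) ‖ ≤ ∣ c ∣ * ‖ x ‖
  ‖c*x‖≤ c x = ≤-trans
    (sum-mono-≤ (λ h → ≤-trans (*-monoˡ-≤ (0≤n·1 (y h)) (∣x*y∣≤∣x∣*∣y∣ c (x h)))
      (≤-reflexive (solve 3 (λ y c x → y :* (c :* x) := c :* (y :* x)) refl (y h · 1#) ∣ c ∣ ∣ x h ∣))))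
    (≤-reflexive (sym (*-distribˡ-sum ∣ c ∣ (λ h → y h · 1# * ∣ x h ∣))))

  ‖∑‖≤ : ∀ {n} (x : Fin n → Fin ∣E∣ → Carrier) → ‖ (λ h → sum (λ i → x i h)) ‖ ≤ sum (λ i → ‖ x i ‖)
  ‖∑‖≤ {zero}  x = ‖0‖≤0
  ‖∑‖≤ {suc n} x = ≤-trans (‖x+x′‖≤ (x zero) (λ h → sum (λ i → x (suc i) h)))
    (+-mono-≤ ≤-refl (‖∑‖≤ (x ∘ suc)))

  ‖edge‖≤ : ∀ e → ‖ edge e ‖ ≤ y e · 1#
  ‖edge‖≤ e = ≤-trans
    (sum-mono-≤ (λ h → ≤-trans (*-monoˡ-≤ (0≤n·1 (y h)) (∣indicator∣≤ (does (e ≟ h))))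
      (≤-reflexive (*-comm _ _))))
    (≤-reflexive (sum-δ e (λ h → y h · 1#)))
    where
    ∣indicator∣≤ : ∀ b → ∣ indicator b ∣ ≤ indicator b
    ∣indicator∣≤ b = ∣x∣≤ ≤-refl (≤-gap (solve 1 (λ i → i :- (:- i) := i :+ i) refl (indicator b))
      (+-nonneg (0≤indicator b) (0≤indicator b)))

  ‖walkFlow‖≤ : ∀ {u v} (p : Walk u v) → ‖ walkFlow p ‖ ≤ length p · 1#
  ‖walkFlow‖≤ []          = ‖0‖≤0
  ‖walkFlow‖≤ (forth e p) = ≤-trans (‖x+x′‖≤ (edge e) (walkFlow p))
    (≤-trans (+-mono-≤ (‖edge‖≤ e) (‖walkFlow‖≤ p)) (≤-reflexive (sym (×-homo-+ 1# (y e) (length p)))))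
  ‖walkFlow‖≤ (back e p)  = ≤-trans (‖x+x′‖≤ (walkFlow p) (λ h → - edge e h))
    (≤-trans (+-mono-≤ (‖walkFlow‖≤ p) (≤-trans (sum-mono-≤
      (λ h → *-monoˡ-≤ (0≤n·1 (y h)) (∣-x∣≤ (edge e h)))) (‖edge‖≤ e)))
      (≤-reflexive (trans (+-comm _ _) (sym (×-homo-+ 1# (y e) (length p))))))
    where
    ∣-x∣≤ : ∀ x → ∣ - x ∣ ≤ ∣ x ∣
    ∣-x∣≤ x = ∣x∣≤ (-x≤∣x∣ x) (≤-trans (≤-reflexive (solve 1 (λ x → :- (:- x) := x) refl x)) (x≤∣x∣ x))

  -- Transport between uniform distributions on balls.

  ball : ℕ → Fin ∣V∣ → Fin k → Bool
  ball r v t = does (near? r v (to t))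

  ball-⊆ : ∀ {r s u v} → (∀ {t} → Near r u t → Near s v t) → ball r u ⊆ ball s v
  ball-⊆ {r} {s} {u} {v} f t t∈r = ⇒does (near? s v (to t)) (f (does⇒ (near? r u (to t)) t∈r))

  μ : ℕ → Fin ∣V∣ → Fin k → Carrier
  μ r v = uniform (ball r v)

  -- The distribution `μ r v` on terminals, pushed forward to the vertices.
  barycentre : ℕ → Fin ∣V∣ → Fin ∣V∣ → Carrier
  barycentre r v x = sum (λ a → μ r v a * δ (to a) x)

  -- The default is 0 when no walk exists. The chosen walk depends only on the radius and its two
  -- ends, not on the vertex whose mass is being moved.
  shortcut : ℕ → Fin k → Fin k → Fin ∣E∣ → Carrier
  shortcut r a b h with near? r (to a) (to b)
  ... | yes (p , _) = walkFlow p h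
  ... | no  _       = 0#

  ‖shortcut‖≤ : ∀ r a b → ‖ shortcut r a b ‖ ≤ r · 1#
  ‖shortcut‖≤ r a b with near? r (to a) (to b)
  ... | yes (p , p<r) = ≤-trans (‖walkFlow‖≤ p) (n·1-mono-≤ (ℕ.<⇒≤ p<r))
  ... | no  _         = ≤-trans ‖0‖≤0 (0≤n·1 r)

  ∂-shortcut : ∀ {r a b} → Near r (to a) (to b) → ∀ x → ∂ (shortcut r a b) x ≈ δ (to a) x - δ (to b) x
  ∂-shortcut {r} {a} {b} near x with near? r (to a) (to b)
  ... | yes (p , _) = ∂-walkFlow p x
  ... | no  ¬near   = ⊥-elim (¬near near)

  -- Mass moves by the product coupling. Terminals of positive weight are within `r` and `n` of the
  -- common vertex `v`, so a shortcut of length below `r + n` joins them.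
  transport : ℕ → ℕ → Fin ∣V∣ → Fin ∣E∣ → Carrier
  transport r n v h = sum (λ a → sum (λ b → μ r v a * μ n v b * shortcut (r ℕ.+ n) a b h))

  -- The marginals of the product coupling are the two distributions: both balls contain the
  -- terminal `s`, so both masses are 1.
  ∂-transport : ∀ r n s x → ∂ (transport (suc r) (suc n) (to s)) x ≈
    barycentre (suc r) (to s) x - barycentre (suc n) (to s) x
  ∂-transport r n s x = begin
    ∂ (transport ρ ν v) x
      ≈⟨ trans (∂-cong (λ h → sum-cong-≋ (λ a → sym (*-identityˡ
        (sum (λ b → μ ρ v a * μ ν v b * shortcut (ρ ℕ.+ ν) a b h))))) x)
           (trans (∂-∑ (λ _ → 1#) (λ a h → sum (λ b → μ ρ v a * μ ν v b * shortcut (ρ ℕ.+ ν) a b h)) x)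
             (sum-cong-≋ (λ a → trans (*-identityˡ _) (∂-∑ (λ b → μ ρ v a * μ ν v b)
               (shortcut (ρ ℕ.+ ν) a) x)))) ⟩
    sum (λ a → sum (λ b → μ ρ v a * μ ν v b * ∂ (shortcut (ρ ℕ.+ ν) a b) x))
      ≈⟨ sum-cong-≋ (λ a → sum-cong-≋ (λ b → endpoints a b)) ⟩
    sum (λ a → sum (λ b → μ ρ v a * μ ν v b * (δ (to a) x - δ (to b) x)))
      ≈⟨ sum-cong-≋ (λ a → trans (sum-cong-≋ (λ b → solve 4
             (λ p q s t → p :* q :* (s :- t) := p :* s :* q :- p :* (q :* t)) refl (μ ρ v a) (μ ν v b)
               (δ (to a) x) (δ (to b) x)))
           (trans (sum-distrib-- (λ b → μ ρ v a * δ (to a) x * μ ν v b)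
             (λ b → μ ρ v a * (μ ν v b * δ (to b) x)))
             (+-cong (trans (sym (*-distribˡ-sum _ (μ ν v))) (trans (*-congˡ (mass n)) (*-identityʳ _)))
               (-‿cong (sym (*-distribˡ-sum (μ ρ v a) (λ b → μ ν v b * δ (to b) x))))))) ⟩
    sum (λ a → μ ρ v a * δ (to a) x - μ ρ v a * barycentre ν v x)
      ≈⟨ trans (sum-distrib-- (λ a → μ ρ v a * δ (to a) x) (λ a → μ ρ v a * barycentre ν v x))
           (+-congˡ (-‿cong (trans (sym (*-distribʳ-sum _ (μ ρ v)))
             (trans (*-congʳ (mass r)) (*-identityˡ _))))) ⟩
    barycentre ρ v x - barycentre ν v x ∎
    where
    open Relation.Binary.Reasoning.Setoid setoid
    ρ ν : ℕ
    ρ = suc r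
    ν = suc n
    v : Fin ∣V∣
    v = to s
    mass : ∀ n → sum (μ (suc n) v) ≈ 1#
    mass n = sum-uniform≈1 (ball (suc n) v) s (⇒does (near? (suc n) v (to s)) Near-refl)
    vanish : ∀ {p q d d′} → p * q ≈ 0# → p * q * d ≈ p * q * d′
    vanish pq≈0 = trans (trans (*-congʳ pq≈0) (zeroˡ _)) (sym (trans (*-congʳ pq≈0) (zeroˡ _)))
    endpoints : ∀ a b → μ ρ v a * μ ν v b * ∂ (shortcut (ρ ℕ.+ ν) a b) x ≈ μ ρ v a * μ ν v b *
      (δ (to a) x - δ (to b) x)
    endpoints a b with near? ρ v (to a) | near? ν v (to b)
    ... | yes va | yes vb = *-congˡ (∂-shortcut (Near-trans (Near-sym va) vb) x)
    ... | no _   | _      = vanish (trans (*-congʳ (zeroˡ _)) (zeroˡ _))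
    ... | yes _  | no _   = vanish (trans (*-congˡ (zeroˡ _)) (zeroʳ _))

  -- The expected route from v, at scale r, to a root: descend the dyadic tree of
  -- radii at random, moving between uniform terminals of consecutive balls.
  ascent : ℕ → ℕ → Fin ∣V∣ → Fin ∣E∣ → Carrier
  ascent zero    r v h = 0#
  ascent (suc L) r v h = 1/ 2 *
    ((transport r (r ℕ.+ r) v h + ascent L (r ℕ.+ r) v h)
    + (transport r (suc (r ℕ.+ r)) v h + ascent L (suc (r ℕ.+ r)) v h))

  barycentre-Connected : ∀ {r u v} → diameter ℕ.≤ r → Connected u v → ∀ x → barycentre r u x ≈ barycentre r v x
  barycentre-Connected {r} {u} {v} d≤r conn x = sum-cong-≋ λ a → *-congʳ (uniform-cong u⊆v v⊆u a)
    where
    u⊆v : ball r u ⊆ ball r v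
    u⊆v = ball-⊆ (Near-Connected d≤r conn)
    v⊆u : ball r v ⊆ ball r u
    v⊆u = ball-⊆ (Near-Connected d≤r (Closure.symmetric _ conn))

  half : ∀ x → 1/ 2 * (x + x) ≈ x
  half x = trans (solve 2 (λ i x → i :* (x :+ x) := 2 :× :1 :* i :* x) refl (1/ 2) x)
    (trans (*-congʳ (n*1/n 1)) (*-identityˡ x))

  -- At every tree edge the barycentre of the child cancels. The leaves have radius at least
  -- `diameter`, where the barycentres of `s` and `t` agree; the hypothesis persists because
  -- doubling a positive radius adds at least 1 while `L` drops by 1.
  ∂-ascent : ∀ {s t} → Connected (to s) (to t) → ∀ L r → diameter ℕ.≤ suc r ℕ.+ L → ∀ x →
    ∂ (ascent L (suc r) (to s)) x - ∂ (ascent L (suc r) (to t)) x ≈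
    barycentre (suc r) (to s) x - barycentre (suc r) (to t) x
  ∂-ascent {s} {t} conn zero r d≤ x = trans (-‿inverseʳ (∂ (λ _ → 0#) x)) (sym (trans
    (+-congʳ (barycentre-Connected (≡.subst (diameter ℕ.≤_) (ℕ.+-identityʳ (suc r)) d≤) conn x))
      (-‿inverseʳ _)))
  ∂-ascent {s} {t} conn (suc L) r d≤ x = trans (+-cong (expand s) (-‿cong (expand t)))
    (trans (solve 7 (λ i p a c q b d → i :* (p :+ a) :- i :* (q :+ b) := i :* ((p :- q) :+ (a :- b))) refl
        (1/ 2) (B (suc r) s - B m s + A m s) (B (suc r) s - B n s + A n s) 0#
        (B (suc r) t - B m t + A m t) (B (suc r) t - B n t + A n t) 0#)
      (trans (*-congˡ (+-cong (child (r ℕ.+ suc r) d≤m) (child (suc (r ℕ.+ suc r)) (ℕ.m≤n⇒m≤1+n d≤m))))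
        (half (B (suc r) s - B (suc r) t))))
    where
    m n : ℕ
    m = suc r ℕ.+ suc r
    n = suc m
    d≤m : diameter ℕ.≤ m ℕ.+ L
    d≤m = ℕ.≤-trans d≤ (≡.subst (ℕ._≤ m ℕ.+ L) (≡.sym (ℕ.+-suc (suc r) L))
      (ℕ.+-monoˡ-≤ L (ℕ.s≤s (ℕ.m≤n+m (suc r) r))))
    A B : ℕ → Fin k → Carrier
    A l s = ∂ (ascent L l (to s)) x
    B l s = barycentre l (to s) x
    expand : ∀ s → ∂ (ascent (suc L) (suc r) (to s)) x ≈
      1/ 2 * ((B (suc r) s - B m s + A m s) + (B (suc r) s - B n s + A n s))
    expand s = trans (∂-* (1/ 2) _ x) (*-congˡ (trans (∂-+ _ _ x) (+-cong
      (trans (∂-+ (transport (suc r) m (to s)) (ascent L m (to s)) x)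
        (+-congʳ (∂-transport r (r ℕ.+ suc r) s x)))
      (trans (∂-+ (transport (suc r) n (to s)) (ascent L n (to s)) x) (+-congʳ (∂-transport r m s x))))))
    child : ∀ l → diameter ℕ.≤ suc l ℕ.+ L →
      (B (suc r) s - B (suc l) s + A (suc l) s) - (B (suc r) t - B (suc l) t + A (suc l) t) ≈ B
        (suc r) s - B (suc r) t
    child l d≤l = trans
      (solve 6 (λ a b c d e f → (a :- b :+ c) :- (d :- e :+ f) := (a :- d) :- (b :- e) :+ (c :- f)) refl
        (B (suc r) s) (B (suc l) s) (A (suc l) s) (B (suc r) t) (B (suc l) t) (A (suc l) t))
      (trans (+-congˡ (∂-ascent conn L l d≤l x))
        (solve 2 (λ p q → (p :- q) :+ q := p) refl (B (suc r) s - B (suc r) t) (B (suc l) s - B (suc l) t)))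

  embedding : Fin ∣V∣ → Fin ∣E∣ → Carrier
  embedding = ascent diameter 1

  -- Radius 1 reaches no other vertex, so the tree of radii starts at the point mass on the
  -- terminal.
  barycentre-1 : ∀ s x → barycentre 1 (to s) x ≈ δ (to s) x
  barycentre-1 s x = trans (sum-cong-≋ only)
    (trans (sym (*-distribʳ-sum (δ (to s) x) (μ 1 (to s))))
      (trans (*-congʳ (sum-uniform≈1 (ball 1 (to s)) s (⇒does (near? 1 (to s) (to s)) Near-refl)))
        (*-identityˡ _)))
    where
    only : ∀ a → μ 1 (to s) a * δ (to a) x ≈ μ 1 (to s) a * δ (to s) x
    only a with near? 1 (to s) (to a)
    ... | yes near = *-congˡ (reflexive (≡.cong (λ u → δ u x) (≡.sym (Near-1⇒≡ near))))
    ... | no  _    = trans (trans (*-congʳ (zeroˡ _)) (zeroˡ _)) (sym (trans (*-congʳ (zeroˡ _)) (zeroˡ _)))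

  embedding-routes : RoutesTerminals K embedding
  embedding-routes s t conn x = trans (∂-- (embedding (to s)) (embedding (to t)) x)
    (trans (∂-ascent conn diameter 0 (ℕ.n≤1+n diameter) x)
      (+-cong (barycentre-1 s x) (-‿cong (barycentre-1 t x))))

  -- The stretch of a single edge.

  module _ (e : Fin ∣E∣) where
    open ≤-Reasoning
    private
      u v : Fin ∣V∣
      u = src e
      v = dst e

    g : ℕ → Carrier
    g r = sum (λ a → ∣ μ r u a - μ r v a ∣)

    0≤g : ∀ r → 0# ≤ g r
    0≤g r = sum-nonneg {k} (λ a → 0≤∣x∣ (μ r u a - μ r v a))

    -- Both ends of `e` use the same shortcuts, so only the coupling weights differ. With p, q and
    -- p′, q′ the weights at the two ends, the difference of products is
    -- `q * (p - p′) + p′ * (q - q′)`, and all masses are at most 1.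
    transport-stretch : ∀ r n → ‖ (λ h → transport r n u h - transport r n v h) ‖ ≤ (r ℕ.+ n) · 1# *
      (g r + g n)
    transport-stretch r n = begin
      ‖ (λ h → transport r n u h - transport r n v h) ‖
        ≤⟨ ‖‖-mono (λ h → trans (sym (sum-distrib-- (λ a → sum
          (λ b → μ r u a * μ n u b * shortcut (r ℕ.+ n) a b h))
                                               (λ a → sum (λ b → μ r v a * μ n v b * shortcut
                                                 (r ℕ.+ n) a b h))))
             (sum-cong-≋ (λ a → trans (sym (sum-distrib-- (λ b → μ r u a * μ n u b * shortcut (r ℕ.+ n) a b h)
                                                    (λ b → μ r v a * μ n v b * shortcut (r ℕ.+ n) a b h)))
             (sum-cong-≋ (λ b → solve 3 (λ c d s → c :* s :- d :* s := (c :- d) :* s) refl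
               (μ r u a * μ n u b) (μ r v a * μ n v b) (shortcut (r ℕ.+ n) a b h)))))) ⟩
      ‖ (λ h → sum (λ a → sum (λ b → c a b * shortcut (r ℕ.+ n) a b h))) ‖
        ≤⟨ ≤-trans (‖∑‖≤ (λ a h → sum (λ b → c a b * shortcut (r ℕ.+ n) a b h)))
             (sum-mono-≤ (λ a → ≤-trans (‖∑‖≤ (λ b h → c a b * shortcut (r ℕ.+ n) a b h))
               (sum-mono-≤ (λ b → ≤-trans (‖c*x‖≤ (c a b) (shortcut (r ℕ.+ n) a b))
                 (*-monoˡ-≤ (0≤∣x∣ (c a b)) (‖shortcut‖≤ (r ℕ.+ n) a b)))))) ⟩
      sum (λ a → sum (λ b → ∣ c a b ∣ * (r ℕ.+ n) · 1#))
        ≈⟨ trans (*-distribʳ-sum _ (λ a → sum (λ b → ∣ c a b ∣)))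
             (sum-cong-≋ (λ a → *-distribʳ-sum _ (λ b → ∣ c a b ∣))) ⟨
      sum (λ a → sum (λ b → ∣ c a b ∣)) * (r ℕ.+ n) · 1#
        ≤⟨ *-monoʳ-≤ (0≤n·1 (r ℕ.+ n)) (≤-trans (sum-mono-≤ (λ a → row a)) columns) ⟩
      (g r + g n) * (r ℕ.+ n) · 1#
        ≈⟨ *-comm _ _ ⟩
      (r ℕ.+ n) · 1# * (g r + g n) ∎
      where
      c : Fin k → Fin k → Carrier
      c a b = μ r u a * μ n u b - μ r v a * μ n v b
      row : ∀ a → sum (λ b → ∣ c a b ∣) ≤ ∣ μ r u a - μ r v a ∣ + μ r v a * g n
      row a = begin
        sum (λ b → ∣ c a b ∣)
          ≤⟨ sum-mono-≤ (λ b → ≤-trans (∣∣-monoˡ (solve 4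
               (λ p q p′ q′ → p :* q :- p′ :* q′ := q :* (p :- p′) :+ p′ :* (q :- q′)) refl
               (μ r u a) (μ n u b) (μ r v a) (μ n v b)))
             (≤-trans (∣x+y∣≤∣x∣+∣y∣ _ _) (+-mono-≤ (∣x*y∣≤x*∣y∣ (0≤uniform (ball n u) b) _)
               (∣x*y∣≤x*∣y∣ (0≤uniform (ball r v) a) _)))) ⟩
        sum (λ b → μ n u b * ∣ μ r u a - μ r v a ∣ + μ r v a * ∣ μ n u b - μ n v b ∣)
          ≈⟨ trans (∑-distrib-+ (λ b → μ n u b * ∣ μ r u a - μ r v a ∣)
            (λ b → μ r v a * ∣ μ n u b - μ n v b ∣))
               (+-cong (sym (*-distribʳ-sum _ (μ n u))) (sym
                 (*-distribˡ-sum (μ r v a) (λ b → ∣ μ n u b - μ n v b ∣)))) ⟩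
        sum (μ n u) * ∣ μ r u a - μ r v a ∣ + μ r v a * g n
          ≤⟨ +-mono-≤ (≤-trans (*-monoʳ-≤ (0≤∣x∣ _) (sum-uniform≤1 (ball n u)))
            (≤-reflexive (*-identityˡ _))) ≤-refl ⟩
        ∣ μ r u a - μ r v a ∣ + μ r v a * g n ∎
      columns : sum (λ a → ∣ μ r u a - μ r v a ∣ + μ r v a * g n) ≤ g r + g n
      columns = begin
        sum (λ a → ∣ μ r u a - μ r v a ∣ + μ r v a * g n)
          ≈⟨ trans (∑-distrib-+ (λ a → ∣ μ r u a - μ r v a ∣) (λ a → μ r v a * g n))
               (+-congˡ (sym (*-distribʳ-sum (g n) (μ r v)))) ⟩
        g r + sum (μ r v) * g n
          ≤⟨ +-mono-≤ ≤-refl (≤-trans (*-monoʳ-≤ (0≤g n) (sum-uniform≤1 (ball r v)))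
            (≤-reflexive (*-identityˡ _))) ⟩
        g r + g n ∎

    cost : ℕ → ℕ → Carrier
    cost L r = ‖ (λ h → ascent L r u h - ascent L r v h) ‖

    triple : ∀ {t} → 0# ≤ t → 0# ≤ 3 · t
    triple 0≤t = +-nonneg 0≤t (+-nonneg 0≤t (+-nonneg 0≤t ≤-refl))

    -- The factor `1/ 2` per level offsets the doubling of the radius, so all nodes of the tree
    -- count alike. The extra term `3 · (suc r · 1# * g r)` strengthens the induction: it pays for
    -- the share of `g` at a child that the transport from its parent incurs.
    cost-bound : ∀ L r → cost L r + 3 · (suc r · 1# * g r) ≤ 6 · (suc r · 1# * treeSum g L r)

    -- The shortcuts have length at most `r + n`, hence at most three times `suc r`. As `r ≤ n`, the
    -- extra term of the child absorbs the charge to `g n`, and `suc n` being at most twice `suc r`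
    -- turns 6 into 12. The scale is `suc r` since 2r + 2 is exactly its double.
    child-cost : ∀ L r n → r ℕ.≤ n → suc n ℕ.≤ suc r ℕ.+ suc r →
      ‖ (λ h → transport r n u h - transport r n v h) ‖ + cost L n
      ≤ 3 · (suc r · 1# * g r) + 12 · (suc r · 1# * treeSum g L n)
    child-cost L r n r≤n n<2r+2 = begin
      ‖ (λ h → transport r n u h - transport r n v h) ‖ + cost L n
        ≤⟨ +-mono-≤ (≤-trans (transport-stretch r n) (*-monoʳ-≤ (+-nonneg (0≤g r) (0≤g n)) r+n≤)) below ⟩
      3 · p * (g r + g n) + (6 · (q * S) - 3 · (q * g n))
        ≤⟨ ≤-gap (solve 5 (λ p q g g′ s →
               (3 :× (p :* g) :+ 12 :× (p :* s)) :- (3 :× p :* (g :+ g′) :+ (6 :× (q :* s) :- 3 :× (q :* g′)))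
               := 3 :× ((q :- p) :* g′) :+ 6 :× ((p :+ p :- q) :* s)) refl p q (g r) (g n) S)
             (+-nonneg (triple (*-nonneg (x≤y⇒0≤y-x (n·1-mono-≤ (ℕ.s≤s r≤n))) (0≤g n)))
               (≤-trans (*-nonneg (0≤n·1 6) (*-nonneg (x≤y⇒0≤y-x q≤p+p) (0≤treeSum g 0≤g L n)))
                 (≤-reflexive (sym (n·x≈n·1*x 6 _))))) ⟩
      3 · (p * g r) + 12 · (p * S) ∎
      where
      p q S : Carrier
      p = suc r · 1#
      q = suc n · 1#
      S = treeSum g L n
      q≤p+p : q ≤ p + p
      q≤p+p = ≤-trans (n·1-mono-≤ n<2r+2) (≤-reflexive (×-homo-+ 1# (suc r) (suc r)))
      r+n≤ : (r ℕ.+ n) · 1# ≤ 3 · p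
      r+n≤ = ≤-trans (n·1-mono-≤ (ℕ.+-mono-≤ (ℕ.n≤1+n r) (ℕ.≤-trans (ℕ.n≤1+n n) n<2r+2)))
        (≤-reflexive (trans (×-homo-+ 1# (suc r) (suc r ℕ.+ suc r))
          (trans (+-congˡ (×-homo-+ 1# (suc r) (suc r)))
          (solve 1 (λ p → p :+ (p :+ p) := 3 :× p) refl p))))
      below : cost L n ≤ 6 · (q * S) - 3 · (q * g n)
      below = ≤-gap (solve 3 (λ s t c → (s :- t) :- c := s :- (c :+ t)) refl (6 · (q * S)) (3 · (q * g n))
        (cost L n))
        (x≤y⇒0≤y-x (cost-bound L n))

    cost-bound zero r = ≤-trans (+-mono-≤ (≤-trans (‖‖-mono (λ h → -‿inverseʳ 0#)) ‖0‖≤0) ≤-refl)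
      (≤-gap (solve 1 (λ t → 6 :× t :- (:0 :+ 3 :× t) := 3 :× t) refl (suc r · 1# * g r))
        (triple (*-nonneg (0≤n·1 (suc r)) (0≤g r))))
    cost-bound (suc L) r = begin
      cost (suc L) r + 3 · (p * g r)
        ≤⟨ +-mono-≤ (≤-trans (‖‖-mono (λ h → solve 9
               (λ i a b c d a′ b′ c′ d′ → i :* ((a :+ b) :+ (c :+ d)) :- i :* ((a′ :+ b′) :+ (c′ :+ d′))
                 := i :* (((a :- a′) :+ (b :- b′)) :+ ((c :- c′) :+ (d :- d′)))) refl
               (1/ 2) (transport r m u h) (ascent L m u h) (transport r n u h) (ascent L n u h)
               (transport r m v h) (ascent L m v h) (transport r n v h) (ascent L n v h)))
             (≤-trans (‖c*x‖≤ (1/ 2) (λ h → D m h + D n h))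
               (*-monoˡ-≤ (0≤∣x∣ (1/ 2)) (≤-trans (‖x+x′‖≤ (D m) (D n))
                 (+-mono-≤ (child m (ℕ.m≤m+n r r) m<) (child n (ℕ.m≤n⇒m≤1+n (ℕ.m≤m+n r r)) n<)))))) ≤-refl ⟩
      ∣ 1/ 2 ∣ * ((3 · (p * g r) + 12 · (p * S m)) + (3 · (p * g r) + 12 · (p * S n))) + 3 · (p * g r)
        ≈⟨ +-congʳ (*-congʳ (≤-antisym (∣x∣≤ ≤-refl
             (≤-gap (solve 1 (λ i → i :- (:- i) := i :+ i) refl (1/ 2)) (+-nonneg (0≤1/ 2) (0≤1/ 2))))
               (x≤∣x∣ (1/ 2)))) ⟩
      1/ 2 * ((3 · (p * g r) + 12 · (p * S m)) + (3 · (p * g r) + 12 · (p * S n))) + 3 · (p * g r)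
        ≈⟨ +-congʳ (*-congˡ (solve 4 (λ p g s t →
             (3 :× (p :* g) :+ 12 :× (p :* s)) :+ (3 :× (p :* g) :+ 12 :× (p :* t))
             := (3 :× (p :* g) :+ 6 :× (p :* (s :+ t))) :+ (3 :× (p :* g) :+ 6 :× (p :* (s :+ t)))) refl p
               (g r) (S m) (S n))) ⟩
      1/ 2 * (half-cost + half-cost) + 3 · (p * g r)
        ≈⟨ +-congʳ (half half-cost) ⟩
      half-cost + 3 · (p * g r)
        ≈⟨ solve 3 (λ p g s → (3 :× (p :* g) :+ 6 :× (p :* s)) :+ 3 :× (p :* g) := 6 :×
          (p :* (g :+ s))) refl p (g r) (S m + S n) ⟩
      6 · (p * treeSum g (suc L) r) ∎
      where
      m n : ℕ
      m = r ℕ.+ r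
      n = suc m
      p : Carrier
      p = suc r · 1#
      S : ℕ → Carrier
      S = treeSum g L
      half-cost : Carrier
      half-cost = 3 · (p * g r) + 6 · (p * (S m + S n))
      D : ℕ → Fin ∣E∣ → Carrier
      D l h = (transport r l u h - transport r l v h) + (ascent L l u h - ascent L l v h)
      n< : suc n ℕ.≤ suc r ℕ.+ suc r
      n< = ℕ.≤-reflexive (≡.cong suc (≡.sym (ℕ.+-suc r r)))
      m< : suc m ℕ.≤ suc r ℕ.+ suc r
      m< = ℕ.≤-trans (ℕ.n≤1+n _) n<
      child : ∀ l → r ℕ.≤ l → suc l ℕ.≤ suc r ℕ.+ suc r → ‖ D l ‖ ≤ 3 · (p * g r) + 12 · (p * S l)
      child l r≤l l< = ≤-trans (‖x+x′‖≤ (λ h → transport r l u h - transport r l v h)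
        (λ h → ascent L l u h - ascent L l v h))
        (child-cost L r l r≤l l<)

    Φ : ℕ → Carrier
    Φ r = harmonic (count (ball r u))

    η : Carrier
    η = harmonic k

    -- Crossing `e` costs `y e`, so the balls of radius `r` around both ends lie between the balls
    -- around `u` of radii `r ∸ y e` and `y e + r`.
    g≤ : ∀ r → g r ≤ 2 · (Φ (y e ℕ.+ r) - Φ (r ℕ.∸ y e))
    g≤ r = uniform-distance {A = ball (r ℕ.∸ y e) u} {ball r u} {ball r v} {ball (y e ℕ.+ r) u}
      (ball-⊆ (Near-mono (ℕ.m∸n≤m r (y e)))) (ball-⊆ (Near-src⇒dst-∸ e))
      (ball-⊆ (Near-mono (ℕ.m≤n+m r (y e)))) (ball-⊆ (Near-dst⇒src e))

    range-g≤ : ∀ n → range g n ≤ 4 · (y e · 1# * η)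
    range-g≤ n = ≤-trans (range-mono-≤ (λ r → ≤-trans (g≤ r)
      (+-mono-≤ ≤-refl (≤-reflexive (+-identityʳ _)))) n)
      (≤-trans (≤-reflexive (range-distrib-+ w w n))
        (≤-trans (+-mono-≤ window window) (≤-reflexive
          (solve 1 (λ t → 2 :× t :+ 2 :× t := 4 :× t) refl (y e · 1# * η)))))
      where
      w : ℕ → Carrier
      w r = Φ (y e ℕ.+ r) - Φ (r ℕ.∸ y e)
      window : range w n ≤ 2 · (y e · 1# * η)
      window = range-window Φ η (λ r → harmonic-mono {0} {count (ball r u)} ℕ.z≤n)
        (λ r → harmonic-mono (count≤ (ball r u))) (y e) n

    -- The constant 48 is 6 from `cost-bound`, times 2 from `suc r` at the root radius 1, times 4
    -- from `range-g≤`.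
    embedding-stretch : ‖ (λ h → embedding u h - embedding v h) ‖ ≤ 48 · η * y e · 1#
    embedding-stretch = begin
      cost diameter 1
        ≤⟨ ≤-gap (solve 2 (λ a b → (a :+ b) :- a := b) refl (cost diameter 1) (3 · (2 · 1# * g 1)))
             (triple (*-nonneg (0≤n·1 2) (0≤g 1))) ⟩
      cost diameter 1 + 3 · (2 · 1# * g 1)
        ≤⟨ cost-bound diameter 1 ⟩
      6 · (2 · 1# * S)
        ≈⟨ solve 1 (λ s → 6 :× (2 :× :1 :* s) := 12 :× :1 :* s) refl S ⟩
      12 · 1# * S
        ≤⟨ *-monoˡ-≤ (0≤n·1 12) (≤-trans (≤-gap (solve 2 (λ s z → (s :+ z) :- s := z) refl S (g 0)) (0≤g 0))
             (≤-trans (≤-reflexive (proj₂ (treeSum≈range g diameter)))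
               (range-g≤ (proj₁ (treeSum≈range g diameter))))) ⟩
      12 · 1# * 4 · (y e · 1# * η)
        ≈⟨ solve 2 (λ d h → 12 :× :1 :* (4 :× (d :* h)) := 48 :× h :* d) refl (y e · 1#) η ⟩
      48 · η * y e · 1# ∎
      where
      S : Carrier
      S = treeSum g diameter 1

  embedding-Lipschitz : Lipschitz (48 · harmonic k) y embedding
  embedding-Lipschitz e = embedding-stretch e

-- The logarithmic bound and its constant.

open import Data.Nat.Base using (_*_; _≤_)

module LogarithmicScheme (R : Reals) (G : Network R) (k : ℕ) (K : Fin k ↣ Fin (Network.∣V∣ G))
  (2≤k : 2 ≤ k) where
  open RealArithmetic R hiding (_*_; _≤_)
  private
    module R = RealArithmetic R
  open Network G
  open Certificates G using (stretch; RoutesTerminals; module LinearScheme)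
  open UniformDistributions R using (harmonic; harmonic-mono; harmonic≤1+log)

  private
    ℓ : ℕ
    ℓ = ⌈log₂ k ⌉

    1≤ℓ : 1 ≤ ℓ
    1≤ℓ = ⌈log₂⌉-mono-≤ {2} 2≤k

    -- The congestion bound `6 · a + 1#` is at most 288 (1 + ℓ) + 1, where 288 is 6 times 48. Since
    -- `k` is at least 2, `1 ≤ ℓ` absorbs both constants: 577 is 288 + 288 + 1.
    a α : Carrier
    a = 48 · harmonic k
    α = (577 * ℓ) · 1#

    0≤a : 0# R.≤ a
    0≤a = ≤-trans (*-nonneg (0≤n·1 48) (harmonic-mono {0} {k} ℕ.z≤n))
      (≤-reflexive (sym (n·x≈n·1*x 48 (harmonic k))))

    6a+1≤α : 6 · a + 1# R.≤ α
    6a+1≤α = begin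
      6 · a + 1#
        ≈⟨ solve 1 (λ h → 6 :× (48 :× h) :+ :1 := 288 :× :1 :* h :+ 1 :× :1) refl (harmonic k) ⟩
      288 · 1# R.* harmonic k + 1 · 1#
        ≤⟨ +-mono-≤ (*-monoˡ-≤ (0≤n·1 288) (harmonic≤1+log k)) ≤-refl ⟩
      288 · 1# R.* (1 ℕ.+ ℓ) · 1# + 1 · 1#
        ≈⟨ trans (×-homo-+ 1# (288 * (1 ℕ.+ ℓ)) 1) (+-congʳ (×1-homo-* 288 (1 ℕ.+ ℓ))) ⟨
      (288 * (1 ℕ.+ ℓ) ℕ.+ 1) · 1#
        ≤⟨ n·1-mono-≤ arithmetic ⟩
      α ∎
      where
      open ≤-Reasoning
      arithmetic : 288 * (1 ℕ.+ ℓ) ℕ.+ 1 ≤ 577 * ℓ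
      arithmetic = ℕ.≤-trans
        (ℕ.+-mono-≤ (ℕ.*-monoʳ-≤ 288 (ℕ.+-monoˡ-≤ ℓ 1≤ℓ)) 1≤ℓ)
        (ℕ.≤-reflexive (ℕ-Solver.solve 1 (λ l →
          ℕ-Solver.con 288 ℕ-Solver.:*
            (l ℕ-Solver.:+ l) ℕ-Solver.:+ l ℕ-Solver.:= ℕ-Solver.con 577 ℕ-Solver.:* l) ≡.refl ℓ))

    optimum : ∃[ M ] RoutesTerminals K M ×
      (∀ h → sum (λ e → stretch M e h R.* cap e) R.≤ (6 · a + 1#) R.* cap h)
    optimum = Minimax.minimax G K a 0≤a λ y 1≤y →
      let open Embedding G K y 1≤y in embedding , embedding-routes , embedding-Lipschitz

  open LinearScheme K α (0≤n·1 (577 * ℓ)) (proj₁ optimum) (proj₁ (proj₂ optimum))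
    (λ h → ≤-trans (proj₂ (proj₂ optimum) h) (*-monoʳ-≤ (<⇒≤ (cap-pos h)) 6a+1≤α)) public

mainTheorem17 : ∃[ C ] ∀ (R : Reals) (G : Network R) (k : ℕ) (K : Fin k ↣ Fin (Network.∣V∣ G)) → 2 ≤ k →
    Σ (ObliviousScheme G K) (IsOblivious G K (Reals._·_ R (C * ⌈log₂ k ⌉) (Reals.1# R)))
mainTheorem17 = 577 , λ R G k K 2≤k →
  let open LogarithmicScheme R G k K 2≤k in
  linearScheme , linearScheme-oblivious
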